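{- For real $\vartheta$ and $s\ge 0$ put $\alpha=e^{\vartheta s}\cosh s$, $\beta=e^{\vartheta s}\sinh s$, and consider the quadratic form in the four variables $z_i,z_j,u_i,u_j$ $$\Psi_{\vartheta,s}=u_iu_j+z_iz_j+\alpha(z_iu_j+z_ju_i)+\beta(z_iu_i+z_ju_j),$$ whose Hessian has the four eigenvalues (with multiplicity) $$\mu_1=1+e^{(\vartheta+1)s},\quad \mu_2=1-e^{(\vartheta+1)s},\quad \mu_3=-1-e^{(\vartheta-1)s},\quad \mu_4=e^{(\vartheta-1)s}-1.$$ (a) If $s=0$, then for every $\vartheta\in\mathbb{R}$ the eigenvalues $(\mu_1,\mu_2,\mu_3,\mu_4)$ are $2,0,-2,0$, and the edge heat gate $T_e^{(\vartheta)}(0)$ is the identity. (b) If $s>0$, then the Hessian of $\Psi_{\vartheta,s}$ has at most one positive eigenvalue if and only if $-1\le\vartheta\le1$. At $\vartheta=-1$ one has $\mu_2=0$, and at $\vartheta=1$ one has $\mu_4=0$. If $\vartheta<-1$ then $\mu_1$ and $\mu_2$ are both positive, and if $\vartheta>1$ then $\mu_1$ and $\mu_4$ are both positive. In particular, for $s>0$ and $\vartheta\notin[-1,1]$ the polynomial $\Psi_{\vartheta,s}$ is not Lorentzian.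
   Context: The edge heat gate for $e=\{i,j\}$ is the linear operator $T_e^{(\vartheta)}(s)=e^{sL_e^{(\vartheta)}}$ on the space spanned by $1,z_i,z_j,z_iz_j$, where $L_e^{(\vartheta)}(1)=0$, $L_e^{(\vartheta)}(z_iz_j)=0$, $L_e^{(\vartheta)}(z_i)=\vartheta z_i+z_j$, $L_e^{(\vartheta)}(z_j)=z_i+\vartheta z_j$. The quadratic $\Psi_{\vartheta,s}$ is its operator symbol $u_iu_j\,T(1)+u_j\,T(z_i)+u_i\,T(z_j)+T(z_iz_j)$ with $T=T_e^{(\vartheta)}(s)$. Lorentzian polynomials (in the sense of Brändén and Huh): a homogeneous polynomial $f$ of degree $d$ in $N$ variables with nonnegative real coefficients is Lorentzian if (i) its support $J\subseteq\mathbb{N}^N$ (the set of exponents of monomials with nonzero coefficient) is M-convex, meaning that for all $\alpha,\beta\in J$ and every index $i$ with $\alpha_i>\beta_i$ there is an index $j$ with $\alpha_j<\beta_j$ and $\alpha-e_i+e_j\in J$ ($e_i$ the standard unit vectors); and (ii) if $d\ge2$, for every sequence of indices $i_1,\dots,i_{d-2}$ the Hessian matrix of the quadratic form $\partial_{i_1}\cdots\partial_{i_{d-2}}f$ has at most one positive eigenvalue (counted with multiplicity). For a quadratic form ($d=2$), condition (ii) says that its own Hessian has at most one positive eigenvalue. -}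

module Defs where

open import Data.Bool.Base using (true; false; if_then_else_)
open import Data.Fin.Base using (Fin; zero; suc; toℕ; punchIn)
open import Data.Fin.Patterns using (0F; 1F; 2F; 3F)
import Data.Fin.Properties as Fin
import Data.Integer.Base as ℤ
import Data.Integer.Properties as ℤ
open import Data.Nat.Base as ℕ using (ℕ; zero; suc; _!)
import Data.Nat.Properties as ℕ
open import Data.Product.Base using (∃-syntax; _×_; _,_; proj₁; proj₂)
open import Data.Rational.Base as ℚ using (ℚ; 0ℚ; 1ℚ; ½; ∣_∣)
import Data.Rational.Properties as ℚ
open import Data.Rational.Solver using (module +-*-Solver)
import Data.Rational.Unnormalised.Base as ℚᵘ
import Data.Rational.Unnormalised.Properties as ℚᵘ
open import Data.Sum.Base using (_⊎_; inj₁; inj₂)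
open import Data.Vec.Base as Vec using (Vec; _[_]%=_)
import Data.Vec.Properties as Vec
open import Data.Vec.Functional using (Vector; foldr)
open import Relation.Binary.PropositionalEquality
  using (_≡_; _≢_; refl; sym; trans; cong; cong₂; subst; subst₂)
open import Relation.Nullary using (¬_; does)

fromℕ : ℕ → ℚ
fromℕ n = ℤ.+ n ℚ./ 1

1/suc : ℕ → ℚ
1/suc n = ℤ.+ 1 ℚ./ suc n

1/! : ℕ → ℚ
1/! k = (ℤ.+ 1 ℚ./ (k !)) {{k ℕ.!≢0}}

module Estimates where

  open +-*-Solver

  ∣p-q∣≡∣q-p∣ : ∀ p q → ∣ p ℚ.- q ∣ ≡ ∣ q ℚ.- p ∣
  ∣p-q∣≡∣q-p∣ p q = trans (sym (ℚ.∣-p∣≡∣p∣ (p ℚ.- q)))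
    (cong ∣_∣ (solve 2 (λ p q → :- (p :- q) := q :- p) refl p q))

  ∣p-r∣≤ : ∀ p q r → ∣ p ℚ.- r ∣ ℚ.≤ ∣ p ℚ.- q ∣ ℚ.+ ∣ q ℚ.- r ∣
  ∣p-r∣≤ p q r = subst (ℚ._≤ ∣ p ℚ.- q ∣ ℚ.+ ∣ q ℚ.- r ∣)
    (cong ∣_∣ (solve 3 (λ p q r → (p :- q) :+ (q :- r) := p :- r) refl p q r))
    (ℚ.∣p+q∣≤∣p∣+∣q∣ (p ℚ.- q) (q ℚ.- r))

  half : ℚ → ℚ
  half ε = ½ ℚ.* ε

  half+half : ∀ ε → half ε ℚ.+ half ε ≡ ε
  half+half = solve 1 (λ ε → con ½ :* ε :+ con ½ :* ε := ε) refl

  0<half : ∀ {ε} → 0ℚ ℚ.< ε → 0ℚ ℚ.< half ε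
  0<half {ε} 0<ε = subst (ℚ._< half ε) (ℚ.*-zeroʳ ½) (ℚ.*-monoʳ-<-pos ½ 0<ε)

  *-pos : ∀ {p q} → 0ℚ ℚ.< p → 0ℚ ℚ.< q → 0ℚ ℚ.< p ℚ.* q
  *-pos {p} {q} 0<p 0<q = subst (ℚ._< p ℚ.* q) (ℚ.*-zeroʳ p)
    (ℚ.*-monoʳ-<-pos p {{ℚ.positive 0<p}} 0<q)

  *-nonNeg : ∀ {p q} → 0ℚ ℚ.≤ p → 0ℚ ℚ.≤ q → 0ℚ ℚ.≤ p ℚ.* q
  *-nonNeg {p} {q} 0≤p 0≤q = subst (ℚ._≤ p ℚ.* q) (ℚ.*-zeroʳ p)
    (ℚ.*-monoˡ-≤-nonNeg p {{ℚ.nonNegative 0≤p}} 0≤q)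

  +-nonNeg : ∀ {p q} → 0ℚ ℚ.≤ p → 0ℚ ℚ.≤ q → 0ℚ ℚ.≤ p ℚ.+ q
  +-nonNeg = ℚ.+-mono-≤

  *-mono-≤ : ∀ {p q r t} → 0ℚ ℚ.≤ p → 0ℚ ℚ.≤ t → p ℚ.≤ q → r ℚ.≤ t →
             p ℚ.* r ℚ.≤ q ℚ.* t
  *-mono-≤ {p} {q} {r} {t} 0≤p 0≤t p≤q r≤t = ℚ.≤-trans
    (ℚ.*-monoˡ-≤-nonNeg p {{ℚ.nonNegative 0≤p}} r≤t)
    (ℚ.*-monoʳ-≤-nonNeg t {{ℚ.nonNegative 0≤t}} p≤q)

  x≤x+y : ∀ x {y} → 0ℚ ℚ.≤ y → x ℚ.≤ x ℚ.+ y
  x≤x+y x {y} 0≤y = subst (ℚ._≤ x ℚ.+ y) (ℚ.+-identityʳ x) (ℚ.+-monoʳ-≤ x 0≤y)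

  fromℕ-mono : ∀ {m n} → m ℕ.≤ n → fromℕ m ℚ.≤ fromℕ n
  fromℕ-mono {m} {n} m≤n = ℚ.toℚᵘ-cancel-≤
    (ℚᵘ.≤-respˡ-≃ (ℚᵘ.≃-sym (ℚ.toℚᵘ-fromℚᵘ (ℚᵘ.mkℚᵘ (ℤ.+ m) 0)))
    (ℚᵘ.≤-respʳ-≃ (ℚᵘ.≃-sym (ℚ.toℚᵘ-fromℚᵘ (ℚᵘ.mkℚᵘ (ℤ.+ n) 0)))
    (ℚᵘ.*≤* (ℤ.*-monoʳ-≤-nonNeg (ℤ.+ 1) (ℤ.+≤+ m≤n)))))

  fromℕ-suc : ∀ n → fromℕ (suc n) ≡ 1ℚ ℚ.+ fromℕ n
  fromℕ-suc n = ℚ.toℚᵘ-injective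
    (ℚᵘ.≃-trans (ℚ.toℚᵘ-fromℚᵘ (ℚᵘ.mkℚᵘ (ℤ.+ suc n) 0))
    (ℚᵘ.≃-sym (ℚᵘ.≃-trans (ℚ.toℚᵘ-homo-+ 1ℚ (fromℕ n))
    (ℚᵘ.≃-trans (ℚᵘ.+-congʳ (ℚᵘ.mkℚᵘ (ℤ.+ 1) 0) (ℚ.toℚᵘ-fromℚᵘ (ℚᵘ.mkℚᵘ (ℤ.+ n) 0)))
      (ℚᵘ.*≡* (cong (λ i → (ℤ.+ 1 ℤ.+ i) ℤ.* ℤ.+ 1) (ℤ.*-identityʳ (ℤ.+ n))))))))

  0≤fromℕ : ∀ n → 0ℚ ℚ.≤ fromℕ n
  0≤fromℕ n = fromℕ-mono {0} {n} ℕ.z≤n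

  0<fromℕ-suc : ∀ n → 0ℚ ℚ.< fromℕ (suc n)
  0<fromℕ-suc n = ℚ.<-≤-trans (ℚ.positive⁻¹ 1ℚ) (fromℕ-mono {1} {suc n} (ℕ.s≤s ℕ.z≤n))

  archimedean : ∀ p → ∃[ n ] p ℚ.≤ fromℕ n
  archimedean (ℚ.mkℚ i d _) = ℤ.∣ i ∣ , ℚ.toℚᵘ-cancel-≤
    (ℚᵘ.≤-respʳ-≃ (ℚᵘ.≃-sym (ℚ.toℚᵘ-fromℚᵘ (ℚᵘ.mkℚᵘ (ℤ.+ ℤ.∣ i ∣) 0)))
      (ℚᵘ.*≤* (i≤∣i∣*d i d)))
    where
    i≤∣i∣*d : ∀ i d → i ℤ.* ℤ.+ 1 ℤ.≤ ℤ.+ ℤ.∣ i ∣ ℤ.* ℤ.+ suc d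
    i≤∣i∣*d (ℤ.+ k) d = subst₂ ℤ._≤_ (sym (ℤ.*-identityʳ (ℤ.+ k))) (ℤ.pos-* k (suc d))
      (ℤ.+≤+ (ℕ.m≤m*n k (suc d)))
    i≤∣i∣*d ℤ.-[1+ k ] d = ℤ.-≤+

  1/d*b≡1/c : ∀ b c d .{{_ : ℕ.NonZero c}} .{{_ : ℕ.NonZero d}} → d ≡ b ℕ.* c →
             (ℤ.+ 1 ℚ./ d) ℚ.* fromℕ b ≡ ℤ.+ 1 ℚ./ c
  1/d*b≡1/c b (suc c) (suc d) d≡b*c = ℚ.toℚᵘ-injective
    (ℚᵘ.≃-trans (ℚ.toℚᵘ-homo-* (ℤ.+ 1 ℚ./ suc d) (fromℕ b))
    (ℚᵘ.≃-trans (ℚᵘ.*-cong (ℚ.toℚᵘ-fromℚᵘ (ℚᵘ.mkℚᵘ (ℤ.+ 1) d))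
                           (ℚ.toℚᵘ-fromℚᵘ (ℚᵘ.mkℚᵘ (ℤ.+ b) 0)))
    (ℚᵘ.≃-trans (ℚᵘ.*≡* eq) (ℚᵘ.≃-sym (ℚ.toℚᵘ-fromℚᵘ (ℚᵘ.mkℚᵘ (ℤ.+ 1) c))))))
    where
    eq : (ℤ.+ 1 ℤ.* ℤ.+ b) ℤ.* ℤ.+ suc c ≡ ℤ.+ 1 ℤ.* ℤ.+ (suc d ℕ.* 1)
    eq = trans (cong (ℤ._* ℤ.+ suc c) (ℤ.*-identityˡ (ℤ.+ b)))
      (trans (sym (ℤ.pos-* b (suc c)))
      (trans (cong ℤ.+_ (trans (sym d≡b*c) (sym (ℕ.*-identityʳ (suc d)))))
      (sym (ℤ.*-identityˡ (ℤ.+ (suc d ℕ.* 1))))))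

  1/!-suc : ∀ k → 1/! (suc k) ℚ.* fromℕ (suc k) ≡ 1/! k
  1/!-suc k = 1/d*b≡1/c (suc k) (k !) (suc k !) {{k ℕ.!≢0}} {{suc k ℕ.!≢0}} refl

  1/suc* : ∀ n → 1/suc n ℚ.* fromℕ (suc n) ≡ 1ℚ
  1/suc* n = 1/d*b≡1/c (suc n) 1 (suc n) (sym (ℕ.*-identityʳ (suc n)))

  eventually-small : ∀ c ε → 0ℚ ℚ.< ε → ∃[ N ] ∀ n → N ℕ.≤ n → c ℚ.< ε ℚ.* fromℕ (suc n)
  eventually-small c ε 0<ε = N , λ n N≤n → begin-strict
    c                       ≡⟨ ℚ.*-identityˡ c ⟨
    1ℚ ℚ.* c                ≡⟨ cong (ℚ._* c) (ℚ.*-inverseʳ ε) ⟨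
    (ε ℚ.* ℚ.1/ ε) ℚ.* c    ≡⟨ ℚ.*-assoc ε (ℚ.1/ ε) c ⟩
    ε ℚ.* (ℚ.1/ ε ℚ.* c)    ≤⟨ ℚ.*-monoˡ-≤-nonNeg ε (proj₂ bound) ⟩
    ε ℚ.* fromℕ N           <⟨ ℚ.*-monoʳ-<-pos ε (fromℕ-< N≤n) ⟩
    ε ℚ.* fromℕ (suc n)     ∎
    where
    open ℚ.≤-Reasoning
    instance
      _ = ℚ.positive 0<ε
      _ = ℚ.pos⇒nonZero ε
      _ = ℚ.pos⇒nonNeg ε
    bound = archimedean (ℚ.1/ ε ℚ.* c)
    N = proj₁ bound
    fromℕ-< : ∀ {n} → N ℕ.≤ n → fromℕ N ℚ.< fromℕ (suc n)
    fromℕ-< {n} N≤n = subst₂ ℚ._<_ (ℚ.+-identityˡ (fromℕ N)) (sym (fromℕ-suc n))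
      (ℚ.+-mono-<-≤ (ℚ.positive⁻¹ 1ℚ) (fromℕ-mono N≤n))

  1/suc-small : ∀ ε → 0ℚ ℚ.< ε → ∃[ N ] ∀ n → N ℕ.≤ n → 1/suc n ℚ.< ε
  1/suc-small ε 0<ε = proj₁ large , λ n N≤n →
    ℚ.*-cancelʳ-<-nonNeg (fromℕ (suc n)) {{ℚ.nonNegative (0≤fromℕ (suc n))}} {1/suc n} {ε}
      (subst (ℚ._< ε ℚ.* fromℕ (suc n)) (sym (1/suc* n)) (proj₂ large n N≤n))
    where
    large = eventually-small 1ℚ ε 0<ε

  0<1/suc : ∀ n → 0ℚ ℚ.< 1/suc n
  0<1/suc n = ℚ.positive⁻¹ (1/suc n) {{ℚ.normalize-pos 1 (suc n)}}

  pow : ℚ → ℕ → ℚ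
  pow p zero    = 1ℚ
  pow p (suc k) = p ℚ.* pow p k

  -- partial a n = Σ_{k < n} a k / k!
  partial : (ℕ → ℚ) → ℕ → ℚ
  partial a zero    = 0ℚ
  partial a (suc n) = partial a n ℚ.+ 1/! n ℚ.* a n

  0≤1/! : ∀ k → 0ℚ ℚ.≤ 1/! k
  0≤1/! k = ℚ.nonNegative⁻¹ (1/! k) {{ℚ.normalize-nonNeg 1 (k !) {{k ℕ.!≢0}}}}

  0≤pow : ∀ {p} → 0ℚ ℚ.≤ p → ∀ k → 0ℚ ℚ.≤ pow p k
  0≤pow 0≤p zero    = ℚ.nonNegative⁻¹ 1ℚ
  0≤pow 0≤p (suc k) = *-nonNeg 0≤p (0≤pow 0≤p k)

  -- The series Σ a k / k! with ∣ a k ∣ ≤ Mᵏ: once k + 1 ≥ 2M the terms Mᵏ / k!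
  -- at least halve at each step, so tails are at most twice their first term.
  module ExpTail (M : ℚ) (0≤M : 0ℚ ℚ.≤ M) where

    term : ℕ → ℚ
    term k = 1/! k ℚ.* pow M k

    0≤term : ∀ k → 0ℚ ℚ.≤ term k
    0≤term k = *-nonNeg (0≤1/! k) (0≤pow 0≤M k)

    K : ℕ
    K = proj₁ (archimedean (M ℚ.+ M))

    2M≤ : ∀ k → K ℕ.≤ k → M ℚ.+ M ℚ.≤ fromℕ (suc k)
    2M≤ k K≤k = ℚ.≤-trans (proj₂ (archimedean (M ℚ.+ M)))
      (fromℕ-mono (ℕ.m≤n⇒m≤1+n K≤k))

    halving : ∀ k → K ℕ.≤ k → term (suc k) ℚ.+ term (suc k) ℚ.≤ term k
    halving k K≤k = begin
      f ℚ.* (M ℚ.* P) ℚ.+ f ℚ.* (M ℚ.* P)  ≡⟨ solve 3 (λ f M P →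
        f :* (M :* P) :+ f :* (M :* P) := f :* ((M :+ M) :* P)) refl f M P ⟩
      f ℚ.* ((M ℚ.+ M) ℚ.* P)              ≤⟨ ℚ.*-monoˡ-≤-nonNeg f {{ℚ.nonNegative (0≤1/! (suc k))}}
        (ℚ.*-monoʳ-≤-nonNeg P {{ℚ.nonNegative (0≤pow 0≤M k)}} (2M≤ k K≤k)) ⟩
      f ℚ.* (fromℕ (suc k) ℚ.* P)          ≡⟨ ℚ.*-assoc f (fromℕ (suc k)) P ⟨
      (f ℚ.* fromℕ (suc k)) ℚ.* P          ≡⟨ cong (ℚ._* P) (1/!-suc k) ⟩
      term k                               ∎
      where
      open ℚ.≤-Reasoning
      f = 1/! (suc k)
      P = pow M k

    decay : ∀ j → fromℕ (suc j) ℚ.* term (j ℕ.+ K) ℚ.≤ term K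
    decay zero    = ℚ.≤-reflexive (ℚ.*-identityˡ (term K))
    decay (suc j) = begin
      fromℕ (suc (suc j)) ℚ.* t′      ≡⟨ cong (ℚ._* t′) (fromℕ-suc (suc j)) ⟩
      (1ℚ ℚ.+ F) ℚ.* t′               ≤⟨ ℚ.*-monoʳ-≤-nonNeg t′ {{ℚ.nonNegative (0≤term (suc (j ℕ.+ K)))}}
        (ℚ.+-monoˡ-≤ F (fromℕ-mono {1} {suc j} (ℕ.s≤s ℕ.z≤n))) ⟩
      (F ℚ.+ F) ℚ.* t′                ≡⟨ solve 2 (λ F t → (F :+ F) :* t := F :* (t :+ t)) refl F t′ ⟩
      F ℚ.* (t′ ℚ.+ t′)               ≤⟨ ℚ.*-monoˡ-≤-nonNeg F {{ℚ.nonNegative (0≤fromℕ (suc j))}}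
        (halving (j ℕ.+ K) (ℕ.m≤n+m K j)) ⟩
      F ℚ.* term (j ℕ.+ K)            ≤⟨ decay j ⟩
      term K                          ∎
      where
      open ℚ.≤-Reasoning
      F  = fromℕ (suc j)
      t′ = term (suc (j ℕ.+ K))

    module _ (a : ℕ → ℚ) (∣a∣≤ : ∀ k → ∣ a k ∣ ℚ.≤ pow M k) where

      tail′ : ∀ m → K ℕ.≤ m → ∀ d →
        ∣ partial a (d ℕ.+ m) ℚ.- partial a m ∣ ℚ.+ (term (d ℕ.+ m) ℚ.+ term (d ℕ.+ m))
          ℚ.≤ term m ℚ.+ term m
      tail′ m K≤m zero = ℚ.≤-reflexive (trans
        (cong (λ q → ∣ q ∣ ℚ.+ (term m ℚ.+ term m)) (ℚ.+-inverseʳ (partial a m)))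
        (ℚ.+-identityˡ (term m ℚ.+ term m)))
      tail′ m K≤m (suc d) = begin
        ∣ (S ℚ.+ f ℚ.* a j) ℚ.- S₀ ∣ ℚ.+ (t′ ℚ.+ t′)
          ≡⟨ cong (λ q → ∣ q ∣ ℚ.+ (t′ ℚ.+ t′))
               (solve 3 (λ S x S₀ → (S :+ x) :- S₀ := (S :- S₀) :+ x) refl S (f ℚ.* a j) S₀) ⟩
        ∣ (S ℚ.- S₀) ℚ.+ f ℚ.* a j ∣ ℚ.+ (t′ ℚ.+ t′)
          ≤⟨ ℚ.+-mono-≤ (ℚ.∣p+q∣≤∣p∣+∣q∣ (S ℚ.- S₀) (f ℚ.* a j))
               (halving j (ℕ.≤-trans K≤m (ℕ.m≤n+m m d))) ⟩
        (∣ S ℚ.- S₀ ∣ ℚ.+ ∣ f ℚ.* a j ∣) ℚ.+ term j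
          ≤⟨ ℚ.+-monoˡ-≤ (term j) (ℚ.+-monoʳ-≤ ∣ S ℚ.- S₀ ∣ ∣fa∣≤) ⟩
        (∣ S ℚ.- S₀ ∣ ℚ.+ term j) ℚ.+ term j
          ≡⟨ ℚ.+-assoc ∣ S ℚ.- S₀ ∣ (term j) (term j) ⟩
        ∣ S ℚ.- S₀ ∣ ℚ.+ (term j ℚ.+ term j)
          ≤⟨ tail′ m K≤m d ⟩
        term m ℚ.+ term m ∎
        where
        open ℚ.≤-Reasoning
        j  = d ℕ.+ m
        S  = partial a j
        S₀ = partial a m
        f  = 1/! j
        t′ = term (suc j)
        ∣fa∣≤ : ∣ f ℚ.* a j ∣ ℚ.≤ term j
        ∣fa∣≤ = subst (ℚ._≤ term j)
          (sym (trans (ℚ.∣p*q∣≡∣p∣*∣q∣ f (a j)) (cong (ℚ._* ∣ a j ∣) (ℚ.0≤p⇒∣p∣≡p (0≤1/! j)))))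
          (ℚ.*-monoˡ-≤-nonNeg f {{ℚ.nonNegative (0≤1/! j)}} (∣a∣≤ j))

      tail : ∀ {m n} → K ℕ.≤ m → m ℕ.≤ n →
        ∣ partial a n ℚ.- partial a m ∣ ℚ.≤ term m ℚ.+ term m
      tail {m} {n} K≤m m≤n = ℚ.≤-trans
        (x≤x+y ∣ partial a n ℚ.- partial a m ∣ (+-nonNeg (0≤term n) (0≤term n)))
        (subst (λ k → ∣ partial a k ℚ.- partial a m ∣ ℚ.+ (term k ℚ.+ term k) ℚ.≤ term m ℚ.+ term m)
          (ℕ.m∸n+n≡m m≤n) (tail′ m K≤m (n ℕ.∸ m)))

    4*_ : ℚ → ℚ
    4* p = (p ℚ.+ p) ℚ.+ (p ℚ.+ p)

    term-small : ∀ ε → 0ℚ ℚ.< ε → ∃[ N ] K ℕ.≤ N × 4* term N ℚ.< ε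
    term-small ε 0<ε = J ℕ.+ K , ℕ.m≤n+m K J ,
      ℚ.*-cancelʳ-<-nonNeg F {{ℚ.nonNegative (0≤fromℕ (suc J))}} {4* t} {ε} (begin-strict
        4* t ℚ.* F     ≡⟨ solve 2 (λ t F → ((t :+ t) :+ (t :+ t)) :* F :=
                            (F :* t :+ F :* t) :+ (F :* t :+ F :* t)) refl t F ⟩
        4* (F ℚ.* t)   ≤⟨ ℚ.+-mono-≤ (ℚ.+-mono-≤ (decay J) (decay J)) (ℚ.+-mono-≤ (decay J) (decay J)) ⟩
        4* term K      <⟨ proj₂ large J ℕ.≤-refl ⟩
        ε ℚ.* F        ∎)
      where
      open ℚ.≤-Reasoning
      large = eventually-small (4* term K) ε 0<ε
      J = proj₁ large
      F = fromℕ (suc J)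
      t = term (J ℕ.+ K)

    uniformly-cauchy : ∀ ε → 0ℚ ℚ.< ε → ∃[ N ] ∀ a → (∀ k → ∣ a k ∣ ℚ.≤ pow M k) →
      ∀ m n → N ℕ.≤ m → N ℕ.≤ n → ∣ partial a m ℚ.- partial a n ∣ ℚ.< ε
    uniformly-cauchy ε 0<ε = N , λ a ∣a∣≤ m n N≤m N≤n → ℚ.≤-<-trans
      (ℚ.≤-trans (∣p-r∣≤ (partial a m) (partial a N) (partial a n))
        (ℚ.+-mono-≤ (tail a ∣a∣≤ K≤N N≤m)
          (subst (ℚ._≤ term N ℚ.+ term N) (∣p-q∣≡∣q-p∣ (partial a n) (partial a N))
            (tail a ∣a∣≤ K≤N N≤n))))
      (proj₂ (proj₂ small))
      where
      small = term-small ε 0<ε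
      N = proj₁ small
      K≤N = proj₁ (proj₂ small)

  Σ≤ : (ℕ → ℚ) → ℕ → ℚ
  Σ≤ x zero    = ∣ x 0 ∣
  Σ≤ x (suc n) = Σ≤ x n ℚ.+ ∣ x (suc n) ∣

  0≤Σ≤ : ∀ x n → 0ℚ ℚ.≤ Σ≤ x n
  0≤Σ≤ x zero    = ℚ.0≤∣p∣ (x 0)
  0≤Σ≤ x (suc n) = +-nonNeg (0≤Σ≤ x n) (ℚ.0≤∣p∣ (x (suc n)))

  ∣x∣≤Σ≤ : ∀ x {i n} → i ℕ.≤′ n → ∣ x i ∣ ℚ.≤ Σ≤ x n
  ∣x∣≤Σ≤ x {zero} {zero} ℕ.≤′-refl = ℚ.≤-refl
  ∣x∣≤Σ≤ x {suc i} ℕ.≤′-refl =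
    subst (ℚ._≤ Σ≤ x (suc i)) (ℚ.+-identityˡ ∣ x (suc i) ∣)
      (ℚ.+-monoˡ-≤ ∣ x (suc i) ∣ (0≤Σ≤ x i))
  ∣x∣≤Σ≤ x {n = suc n} (ℕ.≤′-step i≤n) =
    ℚ.≤-trans (∣x∣≤Σ≤ x i≤n) (x≤x+y (Σ≤ x n) (ℚ.0≤∣p∣ (x (suc n))))

  finite-bound : ∀ {n} (g : Fin n → ℚ) → (∀ j → 0ℚ ℚ.≤ g j) →
                 ∃[ M ] 0ℚ ℚ.≤ M × (∀ j → g j ℚ.≤ M)
  finite-bound {zero}  g 0≤g = 0ℚ , ℚ.≤-refl , λ ()
  finite-bound {suc n} g 0≤g = g zero ℚ.+ M , +-nonNeg (0≤g zero) 0≤M , λ where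
      zero    → x≤x+y (g zero) 0≤M
      (suc j) → ℚ.≤-trans (g≤M j) (subst (M ℚ.≤_) (ℚ.+-comm M (g zero)) (x≤x+y M (0≤g zero)))
    where
    rest = finite-bound {n} (λ j → g (suc j)) (λ j → 0≤g (suc j))
    M = proj₁ rest
    0≤M = proj₁ (proj₂ rest)
    g≤M = proj₂ (proj₂ rest)

  times : ℕ → ℚ → ℚ
  times zero    p = 0ℚ
  times (suc n) p = p ℚ.+ times n p

  times-* : ∀ n p q → times n (p ℚ.* q) ≡ times n p ℚ.* q
  times-* zero    p q = sym (ℚ.*-zeroˡ q)
  times-* (suc n) p q = trans (cong (p ℚ.* q ℚ.+_) (times-* n p q))
    (sym (ℚ.*-distribʳ-+ q p (times n p)))

  0≤times : ∀ n {p} → 0ℚ ℚ.≤ p → 0ℚ ℚ.≤ times n p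
  0≤times zero    0≤p = ℚ.≤-refl
  0≤times (suc n) 0≤p = +-nonNeg 0≤p (0≤times n 0≤p)

-- Real numbers: Cauchy sequences of rationals, with equality _≈_

record ℝ : Set where
  no-eta-equality
  field
    seq    : ℕ → ℚ
    cauchy : ∀ ε → 0ℚ ℚ.< ε →
             ∃[ N ] ∀ m n → N ℕ.≤ m → N ℕ.≤ n → ∣ seq m ℚ.- seq n ∣ ℚ.< ε

open ℝ public

infix 4 _≈_ _<_ _≤_
infixl 6 _+_ _-_
infixl 7 _*_
infix  8 -_
infixr 8 _^_

Within : ℚ → ℝ → ℝ → Set
Within ε x y = ∃[ N ] ∀ n → N ℕ.≤ n → ∣ seq x n ℚ.- seq y n ∣ ℚ.< ε

_≈_ : ℝ → ℝ → Set
x ≈ y = ∀ ε → 0ℚ ℚ.< ε → Within ε x y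

_<_ : ℝ → ℝ → Set
x < y = ∃[ ε ] 0ℚ ℚ.< ε × ∃[ N ] ∀ n → N ℕ.≤ n → seq x n ℚ.+ ε ℚ.≤ seq y n

_≤_ : ℝ → ℝ → Set
x ≤ y = ¬ (y < x)

open Estimates

bound : ℝ → ℚ
bound x = Σ≤ (seq x) (proj₁ (cauchy x 1ℚ (ℚ.positive⁻¹ 1ℚ))) ℚ.+ 1ℚ

0<bound : ∀ x → 0ℚ ℚ.< bound x
0<bound x = ℚ.+-mono-≤-< (0≤Σ≤ (seq x) (proj₁ (cauchy x 1ℚ (ℚ.positive⁻¹ 1ℚ)))) (ℚ.positive⁻¹ 1ℚ)

∣seq∣≤bound : ∀ x i → ∣ seq x i ∣ ℚ.≤ bound x
∣seq∣≤bound x i = helper (ℕ.≤-total i N)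
  where
  open ℚ.≤-Reasoning
  open +-*-Solver
  N = proj₁ (cauchy x 1ℚ (ℚ.positive⁻¹ 1ℚ))
  S = Σ≤ (seq x) N
  helper : i ℕ.≤ N ⊎ N ℕ.≤ i → ∣ seq x i ∣ ℚ.≤ S ℚ.+ 1ℚ
  helper (inj₁ i≤N) = ℚ.≤-trans (∣x∣≤Σ≤ (seq x) (ℕ.≤⇒≤′ i≤N))
    (x≤x+y S (ℚ.nonNegative⁻¹ 1ℚ))
  helper (inj₂ N≤i) = begin
    ∣ seq x i ∣
      ≡⟨ cong ∣_∣ (solve 2 (λ p q → p := q :+ (p :- q)) refl (seq x i) (seq x N)) ⟩
    ∣ seq x N ℚ.+ (seq x i ℚ.- seq x N) ∣
      ≤⟨ ℚ.∣p+q∣≤∣p∣+∣q∣ (seq x N) (seq x i ℚ.- seq x N) ⟩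
    ∣ seq x N ∣ ℚ.+ ∣ seq x i ℚ.- seq x N ∣
      ≤⟨ ℚ.+-mono-≤ (∣x∣≤Σ≤ (seq x) (ℕ.≤′-refl {N}))
           (ℚ.<⇒≤ (proj₂ (cauchy x 1ℚ (ℚ.positive⁻¹ 1ℚ)) i N N≤i ℕ.≤-refl)) ⟩
    S ℚ.+ 1ℚ ∎

fromℚ : ℚ → ℝ
seq    (fromℚ p) _       = p
cauchy (fromℚ p) ε 0<ε = 0 , λ _ _ _ _ → subst (ℚ._< ε) (cong ∣_∣ (sym (ℚ.+-inverseʳ p))) 0<ε

_+_ : ℝ → ℝ → ℝ
seq    (x + y) n     = seq x n ℚ.+ seq y n
cauchy (x + y) ε 0<ε = Nx ℕ.⊔ Ny , λ m n N≤m N≤n → begin-strict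
  ∣ (seq x m ℚ.+ seq y m) ℚ.- (seq x n ℚ.+ seq y n) ∣
    ≡⟨ cong ∣_∣ (solve 4 (λ p q r t → (p :+ q) :- (r :+ t) := (p :- r) :+ (q :- t)) refl
         (seq x m) (seq y m) (seq x n) (seq y n)) ⟩
  ∣ (seq x m ℚ.- seq x n) ℚ.+ (seq y m ℚ.- seq y n) ∣
    ≤⟨ ℚ.∣p+q∣≤∣p∣+∣q∣ (seq x m ℚ.- seq x n) (seq y m ℚ.- seq y n) ⟩
  ∣ seq x m ℚ.- seq x n ∣ ℚ.+ ∣ seq y m ℚ.- seq y n ∣
    <⟨ ℚ.+-mono-<
         (proj₂ cx m n (ℕ.≤-trans (ℕ.m≤m⊔n Nx Ny) N≤m) (ℕ.≤-trans (ℕ.m≤m⊔n Nx Ny) N≤n))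
         (proj₂ cy m n (ℕ.≤-trans (ℕ.m≤n⊔m Nx Ny) N≤m) (ℕ.≤-trans (ℕ.m≤n⊔m Nx Ny) N≤n)) ⟩
  half ε ℚ.+ half ε
    ≡⟨ half+half ε ⟩
  ε ∎
  where
  open ℚ.≤-Reasoning
  open +-*-Solver
  cx = cauchy x (half ε) (0<half 0<ε)
  cy = cauchy y (half ε) (0<half 0<ε)
  Nx = proj₁ cx
  Ny = proj₁ cy

-_ : ℝ → ℝ
seq    (- x) n     = ℚ.- seq x n
cauchy (- x) ε 0<ε = proj₁ cx , λ m n N≤m N≤n → subst (ℚ._< ε)
  (trans (∣p-q∣≡∣q-p∣ (seq x m) (seq x n))
    (cong ∣_∣ (solve 2 (λ p q → q :- p := :- p :- :- q) refl (seq x m) (seq x n))))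
  (proj₂ cx m n N≤m N≤n)
  where
  open +-*-Solver
  cx = cauchy x ε 0<ε

_-_ : ℝ → ℝ → ℝ
x - y = x + (- y)

_*_ : ℝ → ℝ → ℝ
seq    (x * y) n     = seq x n ℚ.* seq y n
cauchy (x * y) ε 0<ε = Nx ℕ.⊔ Ny , λ m n N≤m N≤n → begin-strict
  ∣ seq x m ℚ.* seq y m ℚ.- seq x n ℚ.* seq y n ∣
    ≡⟨ cong ∣_∣ (solve 4 (λ p q r t → p :* q :- r :* t := p :* (q :- t) :+ t :* (p :- r)) refl
         (seq x m) (seq y m) (seq x n) (seq y n)) ⟩
  ∣ seq x m ℚ.* (seq y m ℚ.- seq y n) ℚ.+ seq y n ℚ.* (seq x m ℚ.- seq x n) ∣
    ≤⟨ ℚ.∣p+q∣≤∣p∣+∣q∣ (seq x m ℚ.* (seq y m ℚ.- seq y n)) (seq y n ℚ.* (seq x m ℚ.- seq x n)) ⟩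
  ∣ seq x m ℚ.* (seq y m ℚ.- seq y n) ∣ ℚ.+ ∣ seq y n ℚ.* (seq x m ℚ.- seq x n) ∣
    ≡⟨ cong₂ ℚ._+_ (ℚ.∣p*q∣≡∣p∣*∣q∣ (seq x m) (seq y m ℚ.- seq y n))
                   (ℚ.∣p*q∣≡∣p∣*∣q∣ (seq y n) (seq x m ℚ.- seq x n)) ⟩
  ∣ seq x m ∣ ℚ.* ∣ seq y m ℚ.- seq y n ∣ ℚ.+ ∣ seq y n ∣ ℚ.* ∣ seq x m ℚ.- seq x n ∣
    ≤⟨ ℚ.+-mono-≤
         (ℚ.*-monoʳ-≤-nonNeg ∣ seq y m ℚ.- seq y n ∣
            {{ℚ.∣-∣-nonNeg (seq y m ℚ.- seq y n)}} (∣seq∣≤bound x m))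
         (ℚ.*-monoʳ-≤-nonNeg ∣ seq x m ℚ.- seq x n ∣
            {{ℚ.∣-∣-nonNeg (seq x m ℚ.- seq x n)}} (∣seq∣≤bound y n)) ⟩
  bound x ℚ.* ∣ seq y m ℚ.- seq y n ∣ ℚ.+ bound y ℚ.* ∣ seq x m ℚ.- seq x n ∣
    <⟨ ℚ.+-mono-<
         (ℚ.*-monoʳ-<-pos (bound x) {{ℚ.positive (0<bound x)}}
            (proj₂ cy m n (ℕ.≤-trans (ℕ.m≤n⊔m Nx Ny) N≤m) (ℕ.≤-trans (ℕ.m≤n⊔m Nx Ny) N≤n)))
         (ℚ.*-monoʳ-<-pos (bound y) {{ℚ.positive (0<bound y)}}
            (proj₂ cx m n (ℕ.≤-trans (ℕ.m≤m⊔n Nx Ny) N≤m) (ℕ.≤-trans (ℕ.m≤m⊔n Nx Ny) N≤n))) ⟩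
  bound x ℚ.* δ ℚ.+ bound y ℚ.* δ
    ≡⟨ solve 4 (λ p q r t → p :* (r :* t) :+ q :* (r :* t) := ((p :+ q) :* r) :* t) refl
         (bound x) (bound y) (ℚ.1/ B) ε ⟩
  (B ℚ.* ℚ.1/ B) ℚ.* ε
    ≡⟨ cong (ℚ._* ε) (ℚ.*-inverseʳ B) ⟩
  1ℚ ℚ.* ε
    ≡⟨ ℚ.*-identityˡ ε ⟩
  ε ∎
  where
  open ℚ.≤-Reasoning
  open +-*-Solver
  B = bound x ℚ.+ bound y
  instance
    B-positive = ℚ.positive {B} (ℚ.+-mono-< (0<bound x) (0<bound y))
    B-nonZero = ℚ.pos⇒nonZero B
  δ = ℚ.1/ B ℚ.* ε
  0<δ : 0ℚ ℚ.< δ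
  0<δ = *-pos (ℚ.positive⁻¹ (ℚ.1/ B) {{ℚ.1/pos⇒pos B}}) 0<ε
  cx = cauchy x δ 0<δ
  cy = cauchy y δ 0<δ
  Nx = proj₁ cx
  Ny = proj₁ cy

IsCauchy : (ℕ → ℝ) → Set
IsCauchy X = ∀ ε → 0ℚ ℚ.< ε → ∃[ N ] ∀ m n → N ℕ.≤ m → N ℕ.≤ n → Within ε (X m) (X n)

-- The n-th approximation to the limit is taken from X n at an index beyond
-- which X n varies by less than 1 / (n + 1).
lim : (X : ℕ → ℝ) → IsCauchy X → ℝ
seq    (lim X cX) n = seq (X n) (proj₁ (cauchy (X n) (1/suc n) (0<1/suc n)))
cauchy (lim X cX) ε 0<ε = N , close
  where
  open ℚ.≤-Reasoning
  ε/2 = half ε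
  ε/4 = half ε/2
  0<ε/2 = 0<half 0<ε
  0<ε/4 = 0<half 0<ε/2
  cε = cX ε/2 0<ε/2
  small = 1/suc-small ε/4 0<ε/4
  N = proj₁ cε ℕ.⊔ proj₁ small
  index : ℕ → ℕ
  index n = proj₁ (cauchy (X n) (1/suc n) (0<1/suc n))
  close : ∀ m n → N ℕ.≤ m → N ℕ.≤ n →
          ∣ seq (X m) (index m) ℚ.- seq (X n) (index n) ∣ ℚ.< ε
  close m n N≤m N≤n = begin-strict
    ∣ a ℚ.- d ∣
      ≤⟨ ∣p-r∣≤ a b d ⟩
    ∣ a ℚ.- b ∣ ℚ.+ ∣ b ℚ.- d ∣
      ≤⟨ ℚ.+-monoʳ-≤ ∣ a ℚ.- b ∣ (∣p-r∣≤ b c d) ⟩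
    ∣ a ℚ.- b ∣ ℚ.+ (∣ b ℚ.- c ∣ ℚ.+ ∣ c ℚ.- d ∣)
      <⟨ ℚ.+-mono-< a~b (ℚ.+-mono-< b~c c~d) ⟩
    ε/4 ℚ.+ (ε/2 ℚ.+ ε/4)
      ≡⟨ solve 1 (λ ε → con ½ :* (con ½ :* ε) :+ (con ½ :* ε :+ con ½ :* (con ½ :* ε)) := ε) refl ε ⟩
    ε ∎
    where
    open +-*-Solver
    within = proj₂ cε m n (ℕ.≤-trans (ℕ.m≤m⊔n (proj₁ cε) (proj₁ small)) N≤m)
                          (ℕ.≤-trans (ℕ.m≤m⊔n (proj₁ cε) (proj₁ small)) N≤n)
    i = (index m ℕ.⊔ index n) ℕ.⊔ proj₁ within
    m≤i : index m ℕ.≤ i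
    m≤i = ℕ.≤-trans (ℕ.m≤m⊔n (index m) (index n)) (ℕ.m≤m⊔n (index m ℕ.⊔ index n) (proj₁ within))
    n≤i : index n ℕ.≤ i
    n≤i = ℕ.≤-trans (ℕ.m≤n⊔m (index m) (index n)) (ℕ.m≤m⊔n (index m ℕ.⊔ index n) (proj₁ within))
    a = seq (X m) (index m)
    b = seq (X m) i
    c = seq (X n) i
    d = seq (X n) (index n)
    a~b : ∣ a ℚ.- b ∣ ℚ.< ε/4
    a~b = ℚ.<-trans (proj₂ (cauchy (X m) (1/suc m) (0<1/suc m)) (index m) i ℕ.≤-refl m≤i)
      (proj₂ small m (ℕ.≤-trans (ℕ.m≤n⊔m (proj₁ cε) (proj₁ small)) N≤m))
    b~c : ∣ b ℚ.- c ∣ ℚ.< ε/2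
    b~c = proj₂ within i (ℕ.m≤n⊔m (index m ℕ.⊔ index n) (proj₁ within))
    c~d : ∣ c ℚ.- d ∣ ℚ.< ε/4
    c~d = ℚ.<-trans (proj₂ (cauchy (X n) (1/suc n) (0<1/suc n)) i (index n) n≤i ℕ.≤-refl)
      (proj₂ small n (ℕ.≤-trans (ℕ.m≤n⊔m (proj₁ cε) (proj₁ small)) N≤n))

0ℝ 1ℝ 2ℝ : ℝ
0ℝ = fromℚ 0ℚ
1ℝ = fromℚ 1ℚ
2ℝ = 1ℝ + 1ℝ

_^_ : ℝ → ℕ → ℝ
x ^ zero  = 1ℝ
x ^ suc k = x * x ^ k

∑ ∏ : ∀ {n} → Vector ℝ n → ℝ
∑ = foldr _+_ 0ℝ
∏ = foldr _*_ 1ℝ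

-- partialSum a n = Σ_{k < n} a k / k!
partialSum : (ℕ → ℝ) → ℕ → ℝ
partialSum a zero    = 0ℝ
partialSum a (suc n) = partialSum a n + fromℚ (1/! n) * a n

GeometricallyBounded : (ℕ → ℝ) → Set
GeometricallyBounded a =
  ∃[ M ] 0ℚ ℚ.≤ M × (∀ k i → ∣ seq (a k) i ∣ ℚ.≤ pow M k)

partialSum-cauchy : ∀ a → GeometricallyBounded a → IsCauchy (partialSum a)
partialSum-cauchy a (M , 0≤M , ∣a∣≤) ε 0<ε = proj₁ uc , λ m n N≤m N≤n → 0 , λ i _ →
  subst₂ (λ p q → ∣ p ℚ.- q ∣ ℚ.< ε) (pointwise m i) (pointwise n i)
    (proj₂ uc (λ k → seq (a k) i) (λ k → ∣a∣≤ k i) m n N≤m N≤n)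
  where
  uc = ExpTail.uniformly-cauchy M 0≤M ε 0<ε
  pointwise : ∀ n i → partial (λ k → seq (a k) i) n ≡ seq (partialSum a n) i
  pointwise zero    i = refl
  pointwise (suc n) i = cong (ℚ._+ 1/! n ℚ.* seq (a n) i) (pointwise n i)

-- Σ_{k ≥ 0} a k / k!
expSeries : (a : ℕ → ℝ) → GeometricallyBounded a → ℝ
expSeries a bounded = lim (partialSum a) (partialSum-cauchy a bounded)

powers-bounded : ∀ x → GeometricallyBounded (x ^_)
powers-bounded x = bound x , ℚ.<⇒≤ (0<bound x) , bounded
  where
  bounded : ∀ k i → ∣ seq (x ^ k) i ∣ ℚ.≤ pow (bound x) k
  bounded zero    i = ℚ.≤-refl
  bounded (suc k) i = subst (ℚ._≤ bound x ℚ.* pow (bound x) k)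
    (sym (ℚ.∣p*q∣≡∣p∣*∣q∣ (seq x i) (seq (x ^ k) i)))
    (*-mono-≤ (ℚ.0≤∣p∣ (seq x i)) (0≤pow (ℚ.<⇒≤ (0<bound x)) k) (∣seq∣≤bound x i) (bounded k i))

exp cosh sinh : ℝ → ℝ
exp x  = expSeries (x ^_) (powers-bounded x)
cosh x = fromℚ ½ * (exp x + exp (- x))
sinh x = fromℚ ½ * (exp x - exp (- x))

Matrix : ℕ → Set
Matrix n = Fin n → Fin n → ℝ

identity : ∀ {n} → Matrix n
identity i j = if does (i Fin.≟ j) then 1ℝ else 0ℝ

_⊗_ : ∀ {n} → Matrix n → Matrix n → Matrix n
(A ⊗ B) i j = ∑ λ k → A i k * B k j

scale : ∀ {n} → ℝ → Matrix n → Matrix n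
scale x A i j = x * A i j

_^ᴹ_ : ∀ {n} → Matrix n → ℕ → Matrix n
A ^ᴹ zero  = identity
A ^ᴹ suc k = A ⊗ (A ^ᴹ k)

apply : ∀ {n} → Matrix n → Vector ℝ n → Vector ℝ n
apply A v i = ∑ λ j → A i j * v j

matrix-powers-bounded : ∀ {n} (A : Matrix n) i j → GeometricallyBounded (λ k → (A ^ᴹ k) i j)
matrix-powers-bounded {n} A i j = times n M , 0≤times n 0≤M , λ k → bounded k i j
  where
  rowBound = λ r → finite-bound (λ c → bound (A r c)) (λ c → ℚ.<⇒≤ (0<bound (A r c)))
  total = finite-bound (λ r → proj₁ (rowBound r)) (λ r → proj₁ (proj₂ (rowBound r)))
  M = proj₁ total
  0≤M = proj₁ (proj₂ total)
  entry : ∀ r c m → ∣ seq (A r c) m ∣ ℚ.≤ M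
  entry r c m = ℚ.≤-trans (∣seq∣≤bound (A r c) m)
    (ℚ.≤-trans (proj₂ (proj₂ (rowBound r)) c) (proj₂ (proj₂ total) r))
  ∑-bounded : ∀ {n} (f : Vector ℝ n) B m → (∀ k → ∣ seq (f k) m ∣ ℚ.≤ B) →
              ∣ seq (∑ f) m ∣ ℚ.≤ times n B
  ∑-bounded {zero}  f B m f≤B = ℚ.≤-refl
  ∑-bounded {suc n} f B m f≤B = ℚ.≤-trans
    (ℚ.∣p+q∣≤∣p∣+∣q∣ (seq (f zero) m) (seq (∑ (λ k → f (suc k))) m))
    (ℚ.+-mono-≤ (f≤B zero) (∑-bounded (λ k → f (suc k)) B m (λ k → f≤B (suc k))))
  bounded : ∀ k r c m → ∣ seq ((A ^ᴹ k) r c) m ∣ ℚ.≤ pow (times n M) k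
  bounded zero r c m with does (r Fin.≟ c)
  ... | true  = ℚ.≤-refl
  ... | false = ℚ.nonNegative⁻¹ 1ℚ
  bounded (suc k) r c m = subst (∣ seq ((A ^ᴹ suc k) r c) m ∣ ℚ.≤_)
    (times-* n M (pow (times n M) k))
    (∑-bounded (λ j → A r j * (A ^ᴹ k) j c) (M ℚ.* pow (times n M) k) m λ j →
      subst (ℚ._≤ M ℚ.* pow (times n M) k)
        (sym (ℚ.∣p*q∣≡∣p∣*∣q∣ (seq (A r j) m) (seq ((A ^ᴹ k) j c) m)))
        (*-mono-≤ (ℚ.0≤∣p∣ (seq (A r j) m)) (0≤pow (0≤times n 0≤M) k)
          (entry r j m) (bounded k j c m)))

expᴹ : ∀ {n} → Matrix n → Matrix n
expᴹ A i j = expSeries (λ k → (A ^ᴹ k) i j) (matrix-powers-bounded A i j)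

det : ∀ {n} → Matrix n → ℝ
det {zero}  A = 1ℝ
det {suc n} A = ∑ λ j → ((- 1ℝ) ^ toℕ j * A zero j) * det (λ r c → A (suc r) (punchIn j c))

-- μ lists the eigenvalues of A with multiplicity: det (xI - A) = Π (x - μ i),
-- as polynomial functions of x.
HasEigenvalues : ∀ {n} → Matrix n → Vector ℝ n → Set
HasEigenvalues A μ = ∀ x → det (λ i j → x * identity i j - A i j) ≈ ∏ (λ i → x - μ i)

-- Positive eigenvalues are counted with multiplicity. Intended for symmetric
-- matrices, whose characteristic polynomial splits over ℝ.
AtMostOnePositiveEigenvalue : ∀ {n} → Matrix n → Set
AtMostOnePositiveEigenvalue A = ∃[ μ ] HasEigenvalues A μ ×
  (∀ i j → 0ℝ < μ i → 0ℝ < μ j → i ≡ j)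

-- Polynomials in N variables, as coefficient functions on exponent vectors.
-- Finite support is not imposed here; it follows from homogeneity.

Poly : ℕ → Set
Poly N = Vec ℕ N → ℝ

infixl 6 _⊞_
infixr 7 _•_

_⊞_ : ∀ {N} → Poly N → Poly N → Poly N
(f ⊞ g) α = f α + g α

_•_ : ∀ {N} → ℝ → Poly N → Poly N
(x • f) α = x * f α

monomial : ∀ {N} → Vec ℕ N → Poly N
monomial α β = if does (Vec.≡-dec ℕ._≟_ α β) then 1ℝ else 0ℝ

-- The product of the i-th and the j-th variable, also for i ≡ j
_·_ : ∀ {N} → Fin N → Fin N → Poly N
i · j = monomial (Vec.replicate _ 0 [ i ]%= suc [ j ]%= suc)

∂ : ∀ {N} → Fin N → Poly N → Poly N
∂ i f α = fromℚ (fromℕ (suc (Vec.lookup α i))) * f (α [ i ]%= suc)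

-- For f homogeneous of degree 2, whose second partial derivatives are constant
hessian : ∀ {N} → Poly N → Matrix N
hessian f i j = ∂ i (∂ j f) (Vec.replicate _ 0)

Homogeneous : ∀ {N} → ℕ → Poly N → Set
Homogeneous d f = ∀ α → Vec.sum α ≢ d → f α ≈ 0ℝ

support : ∀ {N} → Poly N → Vec ℕ N → Set
support f α = ¬ (f α ≈ 0ℝ)

MConvex : ∀ {N} → (Vec ℕ N → Set) → Set
MConvex J = ∀ α β → J α → J β → ∀ i → Vec.lookup β i ℕ.< Vec.lookup α i →
  ∃[ j ] Vec.lookup α j ℕ.< Vec.lookup β j × J (α [ i ]%= ℕ.pred [ j ]%= suc)

record IsLorentzian {N} (d : ℕ) (f : Poly N) : Set where
  field
    homogeneous : Homogeneous d f
    nonnegative : ∀ α → 0ℝ ≤ f α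
    mConvex     : MConvex (support f)
    hessians    : 2 ℕ.≤ d → (is : Vec (Fin N) (d ℕ.∸ 2)) →
                  AtMostOnePositiveEigenvalue (hessian (Vec.foldr′ ∂ f is))

pattern zᵢ = 0F
pattern zⱼ = 1F
pattern uᵢ = 2F
pattern uⱼ = 3F

Ψ : ℝ → ℝ → Poly 4
Ψ ϑ s = uᵢ · uⱼ ⊞ zᵢ · zⱼ
      ⊞ α • (zᵢ · uⱼ ⊞ zⱼ · uᵢ)
      ⊞ β • (zᵢ · uᵢ ⊞ zⱼ · uⱼ)
  where
  α = exp (ϑ * s) * cosh s
  β = exp (ϑ * s) * sinh s

μ₁ μ₂ μ₃ μ₄ : ℝ → ℝ → ℝ
μ₁ ϑ s = 1ℝ + exp ((ϑ + 1ℝ) * s)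
μ₂ ϑ s = 1ℝ - exp ((ϑ + 1ℝ) * s)
μ₃ ϑ s = - 1ℝ - exp ((ϑ - 1ℝ) * s)
μ₄ ϑ s = exp ((ϑ - 1ℝ) * s) - 1ℝ

μ : ℝ → ℝ → Vector ℝ 4
μ ϑ s 0F = μ₁ ϑ s
μ ϑ s 1F = μ₂ ϑ s
μ ϑ s 2F = μ₃ ϑ s
μ ϑ s 3F = μ₄ ϑ s

-- The edge heat gate. Polynomials in the span of 1, zᵢ, zⱼ, zᵢzⱼ are given
-- by their coordinates in this basis, in this order; an operator is the
-- matrix whose b-th column is the image of the b-th basis element.

L : ℝ → Matrix 4
L ϑ row col = image col row
  where
  e : Fin 4 → Vector ℝ 4
  e = identity
  image : Fin 4 → Vector ℝ 4
  image 0F k = 0ℝ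
  image 1F k = ϑ * e 1F k + e 2F k
  image 2F k = e 1F k + ϑ * e 2F k
  image 3F k = 0ℝ

T : ℝ → ℝ → Matrix 4
T ϑ s = expᴹ (scale s (L ϑ))

{-# OPTIONS --safe #-}

-- The Hessian of Ψ is a matrix of the Klein four-group, so its eigenvalues are
-- the character sums 1 ± (α + β) and −1 ± (α − β), where α ± β = exp((ϑ ± 1)s)
-- by the addition law of exp. For s > 0 the bounds exp x > 1 if x > 0 and
-- exp x < 1 if x < 0 decide their signs. If ϑ lies outside [−1, 1], then two
-- distinct eigenvalues are positive, and every list of eigenvalues contains
-- both, as they are roots of the characteristic polynomial.

module Submission where

open import Defs
open import Algebra.Bundles using (CommutativeRing)
open import Algebra.Solver.Ring.AlmostCommutativeRing
  using (AlmostCommutativeRing; fromCommutativeRing; _-Raw-AlmostCommutative⟶_)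
import Algebra.Solver.Ring as RingSolver
open import Data.Bool.Base using (if_then_else_)
open import Data.Empty using (⊥; ⊥-elim)
open import Data.Fin.Base using (Fin; zero; suc; toℕ; punchIn)
open import Data.Fin.Patterns using (0F; 1F; 2F; 3F)
import Data.Fin.Properties as Fin
open import Data.Maybe.Base using (map)
open import Data.Nat.Base as ℕ using (ℕ; zero; suc; _!; z≤n; s≤s)
import Data.Nat.Properties as ℕ
open import Data.Product.Base using (∃-syntax; _×_; _,_; proj₁; proj₂)
open import Data.Rational.Base as ℚ using (ℚ; 0ℚ; 1ℚ; ½; ∣_∣)
import Data.Rational.Properties as ℚ
import Data.Rational.Solver as ℚSolver
open import Data.Sum.Base using (_⊎_; inj₁; inj₂; [_,_]′)
open import Data.Vec.Base as Vec using (Vec; []; _[_]%=_)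
import Data.Vec.Properties as Vec
open import Data.Vec.Functional using (Vector; foldr)
open import Function.Base using (_∘_; id)
open import Function.Bundles using (_⇔_; mk⇔; Equivalence)
open import Level using (0ℓ)
open import Relation.Binary.Consequences using (dec⇒weaklyDec)
open import Relation.Binary.PropositionalEquality
  using (_≡_; refl; sym; trans; cong; cong₂; subst; module ≡-Reasoning)
open import Relation.Nullary using (¬_; yes; no; does)

-- The order on Cauchy reals is undecidable, and `x ≤ y` is only the negation of `y < x`; this
-- shapes every sign argument. Case distinctions on signs are replaced by two principles, each
-- settled by inspecting one sufficiently late rational term: if x + y is positive then x or y is
-- (`>0-cotransitive`), and a number that is neither positive nor negative is zero (`≯0⇒≋0`). The
-- first turns the non-strict bound exp x ≥ 1 + x, which is what survives the passage to the limit,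
-- into exp x > 1. The second pulls the sign of exp y - exp x back to y - x. The addition law is the
-- analytic core. At a fixed index a partial sum of the series is a rational exponential sum, so the
-- law reduces to ℚ provided the estimate is uniform in the index. Uniformity comes from a common
-- bound M for both arguments: the error of the truncated Cauchy product is at most the part of the
-- series of exp (M + M) between n and 2n.

open Estimates

-- The reals as a commutative ring

-- A record, because Agda cannot infer x and y from x ≈ y, which unfolds.
infix 4 _≋_
record _≋_ (x y : ℝ) : Set where
  constructor wrap
  field unwrap : x ≈ y

open _≋_ public

-- Ring operations act termwise on sequences, so each ring axiom for ℝ follows through this from the
-- one for ℚ.
pointwise : ∀ {x y} → (∀ n → seq x n ≡ seq y n) → x ≋ y
pointwise {x} {y} eq .unwrap ε 0<ε = 0 , λ n _ → subst (ℚ._< ε)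
  (cong ∣_∣ (trans (sym (ℚ.+-inverseʳ (seq x n))) (cong (λ q → seq x n ℚ.- q) (eq n)))) 0<ε

≋-refl : ∀ {x} → x ≋ x
≋-refl = pointwise λ _ → refl

≋-sym : ∀ {x y} → x ≋ y → y ≋ x
≋-sym {x} {y} x≋y .unwrap ε 0<ε = let N , close = unwrap x≋y ε 0<ε in
  N , λ n N≤n → subst (ℚ._< ε) (∣p-q∣≡∣q-p∣ (seq x n) (seq y n)) (close n N≤n)

∣p-r∣<ε : ∀ p q r {ε} → ∣ p ℚ.- q ∣ ℚ.< half ε → ∣ q ℚ.- r ∣ ℚ.< half ε → ∣ p ℚ.- r ∣ ℚ.< ε
∣p-r∣<ε p q r {ε} pq qr = ℚ.≤-<-trans (∣p-r∣≤ p q r)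
  (subst (∣ p ℚ.- q ∣ ℚ.+ ∣ q ℚ.- r ∣ ℚ.<_) (half+half ε) (ℚ.+-mono-< pq qr))

≋-trans : ∀ {x y z} → x ≋ y → y ≋ z → x ≋ z
≋-trans {x} {y} {z} x≋y y≋z .unwrap ε 0<ε =
  let N₁ , close₁ = unwrap x≋y (half ε) (0<half 0<ε)
      N₂ , close₂ = unwrap y≋z (half ε) (0<half 0<ε)
  in N₁ ℕ.⊔ N₂ , λ n N≤n → ∣p-r∣<ε (seq x n) (seq y n) (seq z n)
       (close₁ n (ℕ.≤-trans (ℕ.m≤m⊔n N₁ N₂) N≤n))
       (close₂ n (ℕ.≤-trans (ℕ.m≤n⊔m N₁ N₂) N≤n))

-‿cong : ∀ {x y} → x ≋ y → - x ≋ - y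
-‿cong {x} {y} x≋y .unwrap ε 0<ε = let N , close = unwrap x≋y ε 0<ε in
  N , λ n N≤n → subst (ℚ._< ε) (eq (seq x n) (seq y n)) (close n N≤n)
  where
  open ℚSolver.+-*-Solver
  eq : ∀ p q → ∣ p ℚ.- q ∣ ≡ ∣ ℚ.- p ℚ.- ℚ.- q ∣
  eq p q = trans (∣p-q∣≡∣q-p∣ p q)
    (cong ∣_∣ (solve 2 (λ p q → q :- p := :- p :- :- q) refl p q))

+-cong : ∀ {x x′ y y′} → x ≋ x′ → y ≋ y′ → x + y ≋ x′ + y′
+-cong {x} {x′} {y} {y′} x≋x′ y≋y′ .unwrap ε 0<ε =
  let N₁ , close₁ = unwrap x≋x′ (half ε) (0<half 0<ε)
      N₂ , close₂ = unwrap y≋y′ (half ε) (0<half 0<ε)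
  in N₁ ℕ.⊔ N₂ , λ n N≤n → ∣p-r∣<ε (seq x n ℚ.+ seq y n) (seq x′ n ℚ.+ seq y n) (seq x′ n ℚ.+ seq y′ n)
       (subst (ℚ._< half ε) (cong ∣_∣ (eq₁ (seq x n) (seq x′ n) (seq y n)))
         (close₁ n (ℕ.≤-trans (ℕ.m≤m⊔n N₁ N₂) N≤n)))
       (subst (ℚ._< half ε) (cong ∣_∣ (eq₂ (seq x′ n) (seq y n) (seq y′ n)))
         (close₂ n (ℕ.≤-trans (ℕ.m≤n⊔m N₁ N₂) N≤n)))
  where
  open ℚSolver.+-*-Solver
  eq₁ : ∀ p q r → p ℚ.- q ≡ (p ℚ.+ r) ℚ.- (q ℚ.+ r)
  eq₁ = solve 3 (λ p q r → p :- q := (p :+ r) :- (q :+ r)) refl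
  eq₂ : ∀ p q r → q ℚ.- r ≡ (p ℚ.+ q) ℚ.- (p ℚ.+ r)
  eq₂ = solve 3 (λ p q r → q :- r := (p :+ q) :- (p :+ r)) refl

-- The splitting pq - rt = p(q - t) + t(p - r) asks for a bound on only one factor of each product.
-- It serves both congruence and limits of products.
∣pq-rt∣< : ∀ p q r t {A B δ} → 0ℚ ℚ.< A → 0ℚ ℚ.< B → ∣ p ∣ ℚ.≤ A → ∣ t ∣ ℚ.≤ B →
  ∣ p ℚ.- r ∣ ℚ.< δ → ∣ q ℚ.- t ∣ ℚ.< δ → ∣ p ℚ.* q ℚ.- r ℚ.* t ∣ ℚ.< (A ℚ.+ B) ℚ.* δ
∣pq-rt∣< p q r t {A} {B} {δ} 0<A 0<B p≤A t≤B pr qt = begin-strict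
  ∣ p ℚ.* q ℚ.- r ℚ.* t ∣
    ≡⟨ cong ∣_∣ (solve 4 (λ p q r t → p :* q :- r :* t := p :* (q :- t) :+ t :* (p :- r)) refl p q r t) ⟩
  ∣ p ℚ.* (q ℚ.- t) ℚ.+ t ℚ.* (p ℚ.- r) ∣
    ≤⟨ ℚ.∣p+q∣≤∣p∣+∣q∣ (p ℚ.* (q ℚ.- t)) (t ℚ.* (p ℚ.- r)) ⟩
  ∣ p ℚ.* (q ℚ.- t) ∣ ℚ.+ ∣ t ℚ.* (p ℚ.- r) ∣
    ≡⟨ cong₂ ℚ._+_ (ℚ.∣p*q∣≡∣p∣*∣q∣ p (q ℚ.- t)) (ℚ.∣p*q∣≡∣p∣*∣q∣ t (p ℚ.- r)) ⟩
  ∣ p ∣ ℚ.* ∣ q ℚ.- t ∣ ℚ.+ ∣ t ∣ ℚ.* ∣ p ℚ.- r ∣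
    ≤⟨ ℚ.+-mono-≤
         (ℚ.*-monoʳ-≤-nonNeg ∣ q ℚ.- t ∣ {{ℚ.∣-∣-nonNeg (q ℚ.- t)}} p≤A)
         (ℚ.*-monoʳ-≤-nonNeg ∣ p ℚ.- r ∣ {{ℚ.∣-∣-nonNeg (p ℚ.- r)}} t≤B) ⟩
  A ℚ.* ∣ q ℚ.- t ∣ ℚ.+ B ℚ.* ∣ p ℚ.- r ∣
    <⟨ ℚ.+-mono-< (ℚ.*-monoʳ-<-pos A {{ℚ.positive 0<A}} qt)
                  (ℚ.*-monoʳ-<-pos B {{ℚ.positive 0<B}} pr) ⟩
  A ℚ.* δ ℚ.+ B ℚ.* δ  ≡⟨ ℚ.*-distribʳ-+ δ A B ⟨
  (A ℚ.+ B) ℚ.* δ      ∎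
  where
  open ℚ.≤-Reasoning
  open ℚSolver.+-*-Solver

quotient : ∀ {B ε} → 0ℚ ℚ.< B → 0ℚ ℚ.< ε → ∃[ δ ] 0ℚ ℚ.< δ × B ℚ.* δ ≡ ε
quotient {B} {ε} 0<B 0<ε = ℚ.1/ B ℚ.* ε ,
  *-pos (ℚ.positive⁻¹ (ℚ.1/ B) {{ℚ.1/pos⇒pos B}}) 0<ε ,
  trans (sym (ℚ.*-assoc B (ℚ.1/ B) ε))
    (trans (cong (ℚ._* ε) (ℚ.*-inverseʳ B)) (ℚ.*-identityˡ ε))
  where
  instance
    _ = ℚ.positive 0<B
    _ = ℚ.pos⇒nonZero B

*-cong : ∀ {x x′ y y′} → x ≋ x′ → y ≋ y′ → x * y ≋ x′ * y′
*-cong {x} {x′} {y} {y′} x≋x′ y≋y′ .unwrap ε 0<ε =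
  let δ , 0<δ , Bδ≡ε = quotient (ℚ.+-mono-< (0<bound x) (0<bound y′)) 0<ε
      N₁ , close₁ = unwrap x≋x′ δ 0<δ
      N₂ , close₂ = unwrap y≋y′ δ 0<δ
  in N₁ ℕ.⊔ N₂ , λ n N≤n → subst (∣ seq x n ℚ.* seq y n ℚ.- seq x′ n ℚ.* seq y′ n ∣ ℚ.<_) Bδ≡ε
       (∣pq-rt∣< (seq x n) (seq y n) (seq x′ n) (seq y′ n) (0<bound x) (0<bound y′) (∣seq∣≤bound x n) (∣seq∣≤bound y′ n)
         (close₁ n (ℕ.≤-trans (ℕ.m≤m⊔n N₁ N₂) N≤n))
         (close₂ n (ℕ.≤-trans (ℕ.m≤n⊔m N₁ N₂) N≤n)))

ℝ-commutativeRing : CommutativeRing 0ℓ 0ℓ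
ℝ-commutativeRing = record
  { Carrier = ℝ ; _≈_ = _≋_ ; _+_ = _+_ ; _*_ = _*_ ; -_ = -_ ; 0# = 0ℝ ; 1# = 1ℝ
  ; isCommutativeRing = record
    { isRing = record
      { +-isAbelianGroup = record
        { isGroup = record
          { isMonoid = record
            { isSemigroup = record
              { isMagma = record
                { isEquivalence = record { refl = ≋-refl ; sym = ≋-sym ; trans = ≋-trans }
                ; ∙-cong = +-cong }
              ; assoc = λ x y z → pointwise λ n → ℚ.+-assoc (seq x n) (seq y n) (seq z n) }
            ; identity = (λ x → pointwise λ n → ℚ.+-identityˡ (seq x n))
                       , (λ x → pointwise λ n → ℚ.+-identityʳ (seq x n)) }
          ; inverse = (λ x → pointwise λ n → ℚ.+-inverseˡ (seq x n))
                    , (λ x → pointwise λ n → ℚ.+-inverseʳ (seq x n))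
          ; ⁻¹-cong = -‿cong }
        ; comm = λ x y → pointwise λ n → ℚ.+-comm (seq x n) (seq y n) }
      ; *-cong = *-cong
      ; *-assoc = λ x y z → pointwise λ n → ℚ.*-assoc (seq x n) (seq y n) (seq z n)
      ; *-identity = (λ x → pointwise λ n → ℚ.*-identityˡ (seq x n))
                   , (λ x → pointwise λ n → ℚ.*-identityʳ (seq x n))
      ; distrib = (λ x y z → pointwise λ n → ℚ.*-distribˡ-+ (seq x n) (seq y n) (seq z n))
                , (λ x y z → pointwise λ n → ℚ.*-distribʳ-+ (seq x n) (seq y n) (seq z n)) }
    ; *-comm = λ x y → pointwise λ n → ℚ.*-comm (seq x n) (seq y n) } }

ℝ-almostCommutativeRing : AlmostCommutativeRing 0ℓ 0ℓ
ℝ-almostCommutativeRing = fromCommutativeRing ℝ-commutativeRing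

-- Rational coefficients let the solver compute with the ½ in `cosh` and `sinh`.
fromℚ-homomorphism : CommutativeRing.rawRing ℚ.+-*-commutativeRing
                     -Raw-AlmostCommutative⟶ ℝ-almostCommutativeRing
fromℚ-homomorphism = record
  { ⟦_⟧    = fromℚ
  ; +-homo = λ _ _ → pointwise λ _ → refl
  ; *-homo = λ _ _ → pointwise λ _ → refl
  ; -‿homo = λ _ → pointwise λ _ → refl
  ; 0-homo = ≋-refl
  ; 1-homo = ≋-refl
  }

module ℝSolver = RingSolver (CommutativeRing.rawRing ℚ.+-*-commutativeRing)
  ℝ-almostCommutativeRing fromℚ-homomorphism
  (λ p q → map (λ p≡q → pointwise λ _ → p≡q) (dec⇒weaklyDec ℚ._≟_ p q))

-- Positivity

infix 4 _>0
-- Inequalities are handled as positivity of a difference, which the ring solver can rewrite.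
record _>0 (x : ℝ) : Set where
  constructor positive
  field
    gap       : ℚ
    0<gap     : 0ℚ ℚ.< gap
    start     : ℕ
    gap≤      : ∀ n → start ℕ.≤ n → gap ℚ.≤ seq x n

<⇒>0 : ∀ x y → x < y → y - x >0
<⇒>0 x y (ε , 0<ε , N , x+ε≤y) = positive ε 0<ε N λ n N≤n →
  subst (ℚ._≤ seq y n ℚ.- seq x n)
    (solve 2 (λ x ε → (x :+ ε) :- x := ε) refl (seq x n) ε)
    (ℚ.+-monoˡ-≤ (ℚ.- seq x n) (x+ε≤y n N≤n))
  where open ℚSolver.+-*-Solver

>0⇒< : ∀ {x y} → y - x >0 → x < y
>0⇒< {x} {y} (positive ε 0<ε N ε≤y-x) = ε , 0<ε , N , λ n N≤n →
  subst (seq x n ℚ.+ ε ℚ.≤_)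
    (solve 2 (λ x y → x :+ (y :- x) := y) refl (seq x n) (seq y n))
    (ℚ.+-monoʳ-≤ (seq x n) (ε≤y-x n N≤n))
  where open ℚSolver.+-*-Solver

p≤∣p∣ : ∀ p → p ℚ.≤ ∣ p ∣
p≤∣p∣ p with ℚ.≤-total 0ℚ p
... | inj₁ 0≤p = ℚ.≤-reflexive (sym (ℚ.0≤p⇒∣p∣≡p 0≤p))
... | inj₂ p≤0 = ℚ.≤-trans p≤0 (ℚ.0≤∣p∣ p)

half≤ : ∀ p q {ε} → ε ℚ.≤ p → ∣ p ℚ.- q ∣ ℚ.< half ε → half ε ℚ.≤ q
half≤ p q {ε} ε≤p p~q = begin
  half ε                       ≡⟨ solve 1 (λ ε → con ½ :* ε := ε :- con ½ :* ε) refl ε ⟩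
  ε ℚ.- half ε                 ≤⟨ ℚ.+-mono-≤ ε≤p (ℚ.neg-antimono-≤ (ℚ.≤-trans (p≤∣p∣ (p ℚ.- q)) (ℚ.<⇒≤ p~q))) ⟩
  p ℚ.- (p ℚ.- q)              ≡⟨ solve 2 (λ p q → p :- (p :- q) := q) refl p q ⟩
  q                            ∎
  where
  open ℚ.≤-Reasoning
  open ℚSolver.+-*-Solver

>0-cong : ∀ {x y} → x ≋ y → x >0 → y >0
>0-cong {x} {y} x≋y (positive ε 0<ε N ε≤x) =
  let N′ , close = unwrap x≋y (half ε) (0<half 0<ε)
  in positive (half ε) (0<half 0<ε) (N ℕ.⊔ N′) λ n N≤n →
    half≤ (seq x n) (seq y n) (ε≤x n (ℕ.≤-trans (ℕ.m≤m⊔n N N′) N≤n))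
      (close n (ℕ.≤-trans (ℕ.m≤n⊔m N N′) N≤n))

+->0 : ∀ {x y} → x >0 → y >0 → x + y >0
+->0 (positive ε 0<ε N ε≤) (positive ε′ 0<ε′ N′ ε′≤) =
  positive (ε ℚ.+ ε′) (ℚ.+-mono-< 0<ε 0<ε′) (N ℕ.⊔ N′) λ n N≤n →
    ℚ.+-mono-≤ (ε≤ n (ℕ.≤-trans (ℕ.m≤m⊔n N N′) N≤n)) (ε′≤ n (ℕ.≤-trans (ℕ.m≤n⊔m N N′) N≤n))

*->0 : ∀ {x y} → x >0 → y >0 → x * y >0
*->0 {x} {y} (positive ε 0<ε N ε≤) (positive ε′ 0<ε′ N′ ε′≤) =
  positive (ε ℚ.* ε′) (*-pos 0<ε 0<ε′) (N ℕ.⊔ N′) λ n N≤n →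
    let ε′≤y = ε′≤ n (ℕ.≤-trans (ℕ.m≤n⊔m N N′) N≤n) in
    *-mono-≤ (ℚ.<⇒≤ 0<ε) (ℚ.≤-trans (ℚ.<⇒≤ 0<ε′) ε′≤y)
      (ε≤ n (ℕ.≤-trans (ℕ.m≤m⊔n N N′) N≤n)) ε′≤y

fromℚ>0 : ∀ {q} → 0ℚ ℚ.< q → fromℚ q >0
fromℚ>0 {q} 0<q = positive q 0<q 0 λ _ _ → ℚ.≤-refl

1>0 : 1ℝ >0
1>0 = fromℚ>0 (ℚ.positive⁻¹ 1ℚ)

0≯0 : ¬ 0ℝ >0
0≯0 (positive ε 0<ε N ε≤0) = ℚ.<-irrefl refl (ℚ.<-≤-trans 0<ε (ε≤0 N ℕ.≤-refl))

-- Where xy ≥ ε and 0 < y ≤ `bound y`, the quotient ε / `bound y` is a gap for x.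
*-cancelʳ->0 : ∀ {x y} → x * y >0 → y >0 → x >0
*-cancelʳ->0 {x} {y} (positive ε 0<ε N ε≤xy) (positive ε′ 0<ε′ N′ ε′≤y) =
  let δ , 0<δ , Bδ≡ε = quotient (0<bound y) 0<ε
  in positive δ 0<δ (N ℕ.⊔ N′) λ n N≤n →
    let 0<y = ℚ.<-≤-trans 0<ε′ (ε′≤y n (ℕ.≤-trans (ℕ.m≤n⊔m N N′) N≤n))
    in ℚ.*-cancelʳ-≤-pos (seq y n) {{ℚ.positive 0<y}} (begin
      δ ℚ.* seq y n      ≤⟨ ℚ.*-monoˡ-≤-nonNeg δ {{ℚ.nonNegative (ℚ.<⇒≤ 0<δ)}}
                              (ℚ.≤-trans (p≤∣p∣ (seq y n)) (∣seq∣≤bound y n)) ⟩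
      δ ℚ.* bound y      ≡⟨ trans (ℚ.*-comm δ (bound y)) Bδ≡ε ⟩
      ε                  ≤⟨ ε≤xy n (ℕ.≤-trans (ℕ.m≤m⊔n N N′) N≤n) ⟩
      seq x n ℚ.* seq y n ∎)
  where open ℚ.≤-Reasoning

index : ∀ (x : ℝ) {ε} → 0ℚ ℚ.< ε → ℕ
index x {ε} 0<ε = proj₁ (cauchy x (half ε) (0<half 0<ε))

-- One late term decides positivity: past `index x 0<ε` the terms differ by less than ε/2, so half
-- of the gap survives.
persistent : ∀ x {ε} (0<ε : 0ℚ ℚ.< ε) {m} → index x 0<ε ℕ.≤ m → ε ℚ.≤ seq x m → x >0
persistent x {ε} 0<ε {m} N≤m ε≤xm = positive (half ε) (0<half 0<ε) (index x 0<ε) λ n N≤n →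
  half≤ (seq x m) (seq x n) ε≤xm (proj₂ (cauchy x (half ε) (0<half 0<ε)) m n N≤m N≤n)

-- If both terms at a late index were below ε/2, their sum would fall below the gap ε. Comparing two
-- rationals therefore decides the alternative.
>0-cotransitive : ∀ x y → x + y >0 → x >0 ⊎ y >0
>0-cotransitive x y (positive ε 0<ε N ε≤) = split (half ε ℚ.≤? seq x m)
  where
  0<ε/2 = 0<half 0<ε
  Nx = index x 0<ε/2
  Ny = index y 0<ε/2
  -- Late enough for the gap of x + y and for `persistent` on x and on y.
  m = N ℕ.⊔ (Nx ℕ.⊔ Ny)
  Nx≤m = ℕ.≤-trans (ℕ.m≤m⊔n Nx Ny) (ℕ.m≤n⊔m N (Nx ℕ.⊔ Ny))
  Ny≤m = ℕ.≤-trans (ℕ.m≤n⊔m Nx Ny) (ℕ.m≤n⊔m N (Nx ℕ.⊔ Ny))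
  split : _ → x >0 ⊎ y >0
  split (yes ε/2≤x) = inj₁ (persistent x 0<ε/2 Nx≤m ε/2≤x)
  split (no ε/2≰x) with half ε ℚ.≤? seq y m
  ... | yes ε/2≤y = inj₂ (persistent y 0<ε/2 Ny≤m ε/2≤y)
  ... | no ε/2≰y = ⊥-elim (ℚ.<-irrefl refl (ℚ.<-≤-trans
    (subst (seq x m ℚ.+ seq y m ℚ.<_) (half+half ε) (ℚ.+-mono-< (ℚ.≰⇒> ε/2≰x) (ℚ.≰⇒> ε/2≰y)))
    (ε≤ m (ℕ.m≤m⊔n N (Nx ℕ.⊔ Ny)))))

-- A late term of absolute value at least ε/2 would, by `persistent`, make x or - x positive.
≯0⇒≋0 : ∀ x → ¬ x >0 → ¬ - x >0 → x ≋ 0ℝ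
≯0⇒≋0 x x≯0 -x≯0 .unwrap ε 0<ε = m , λ n m≤n →
  ∣p-r∣<ε (seq x n) (seq x m) 0ℚ
    (proj₂ (cauchy x (half ε) 0<ε/2) n m (ℕ.≤-trans N₁≤m m≤n) N₁≤m) ∣x∣<ε/2
  where
  0<ε/2 = 0<half 0<ε
  N₁ = index x 0<ε
  N₂ = index x 0<ε/2
  m = N₁ ℕ.⊔ N₂
  N₁≤m = ℕ.m≤m⊔n N₁ N₂
  N₂≤m = ℕ.m≤n⊔m N₁ N₂
  ∣x∣<ε/2 : ∣ seq x m ℚ.- 0ℚ ∣ ℚ.< half ε
  ∣x∣<ε/2 rewrite ℚ.+-identityʳ (seq x m) = ℚ.≰⇒> λ ε/2≤∣x∣ → contra ε/2≤∣x∣ (ℚ.∣p∣≡p∨∣p∣≡-p (seq x m))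
    where
    contra : half ε ℚ.≤ ∣ seq x m ∣ → ∣ seq x m ∣ ≡ seq x m ⊎ ∣ seq x m ∣ ≡ ℚ.- seq x m → ⊥
    contra ε/2≤ (inj₁ eq) = x≯0 (persistent x 0<ε/2 N₂≤m (subst (half ε ℚ.≤_) eq ε/2≤))
    -- Negation keeps the Cauchy modulus, so `N₂` serves - x as well.
    contra ε/2≤ (inj₂ eq) = -x≯0 (persistent (- x) 0<ε/2 N₂≤m (subst (half ε ℚ.≤_) eq ε/2≤))

≋0⇒≯0 : ∀ {x} → x ≋ 0ℝ → ¬ x >0
≋0⇒≯0 x≋0 x>0 = 0≯0 (>0-cong x≋0 x>0)

-- Limits of sequences

infix 4 _⟶_
record _⟶_ (X : ℕ → ℝ) (l : ℝ) : Set where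
  constructor converges
  field within : ∀ ε → 0ℚ ℚ.< ε → ∃[ N ] ∀ n → N ℕ.≤ n → Within ε (X n) l

open _⟶_ public

-- Term i of the limit is a term of `X i` at that number's own index. The path to it from `X n` at i
-- passes through `X n` and `X i` at a common late index j; its steps cost ε/4, ε/4 and ε/2.
lim-converges : ∀ X (cX : IsCauchy X) → X ⟶ lim X cX
lim-converges X cX .within ε 0<ε = N₁ , λ n N₁≤n →
  let cn = cauchy (X n) ε/4 0<ε/4 in
  N₁ ℕ.⊔ N₂ ℕ.⊔ proj₁ cn , λ i N≤i →
  let N₁⊔N₂≤i = ℕ.≤-trans (ℕ.m≤m⊔n (N₁ ℕ.⊔ N₂) (proj₁ cn)) N≤i
      cn≤i = ℕ.≤-trans (ℕ.m≤n⊔m (N₁ ℕ.⊔ N₂) (proj₁ cn)) N≤i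
      N₁≤i = ℕ.≤-trans (ℕ.m≤m⊔n N₁ N₂) N₁⊔N₂≤i
      N₂≤i = ℕ.≤-trans (ℕ.m≤n⊔m N₁ N₂) N₁⊔N₂≤i
      W , close = proj₂ (cX ε/4 0<ε/4) n i N₁≤n N₁≤i
      ci = cauchy (X i) (1/suc i) (0<1/suc i)
      j = W ℕ.⊔ (i ℕ.⊔ proj₁ ci)
      W≤j = ℕ.m≤m⊔n W (i ℕ.⊔ proj₁ ci)
      i⊔ci≤j = ℕ.m≤n⊔m W (i ℕ.⊔ proj₁ ci)
      i≤j = ℕ.≤-trans (ℕ.m≤m⊔n i (proj₁ ci)) i⊔ci≤j
      ci≤j = ℕ.≤-trans (ℕ.m≤n⊔m i (proj₁ ci)) i⊔ci≤j
  in ∣p-r∣<ε (seq (X n) i) (seq (X i) j) (seq (X i) (proj₁ ci))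
       (∣p-r∣<ε (seq (X n) i) (seq (X n) j) (seq (X i) j)
         (proj₂ cn i j cn≤i (ℕ.≤-trans cn≤i i≤j)) (close j W≤j))
       (ℚ.<-trans (proj₂ ci j (proj₁ ci) ci≤j ℕ.≤-refl) (proj₂ small i N₂≤i))
  where
  ε/4 = half (half ε)
  0<ε/4 = 0<half (0<half 0<ε)
  N₁ = proj₁ (cX ε/4 0<ε/4)
  small = 1/suc-small (half ε) (0<half 0<ε)
  N₂ = proj₁ small

converges-shift : ∀ {X Y l} →
  (∀ ε → 0ℚ ℚ.< ε → ∃[ N ] ∀ n → N ℕ.≤ n → Within ε (Y n) (X n)) →
  X ⟶ l → Y ⟶ l
converges-shift {X} {Y} {l} Y~X X→l .within ε 0<ε =
  let N₁ , close₁ = Y~X (half ε) (0<half 0<ε)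
      N₂ , close₂ = within X→l (half ε) (0<half 0<ε)
  in N₁ ℕ.⊔ N₂ , λ n N≤n →
  let M₁ , close₁ = close₁ n (ℕ.≤-trans (ℕ.m≤m⊔n N₁ N₂) N≤n)
      M₂ , close₂ = close₂ n (ℕ.≤-trans (ℕ.m≤n⊔m N₁ N₂) N≤n)
  in M₁ ℕ.⊔ M₂ , λ i M≤i → ∣p-r∣<ε (seq (Y n) i) (seq (X n) i) (seq l i)
       (close₁ i (ℕ.≤-trans (ℕ.m≤m⊔n M₁ M₂) M≤i))
       (close₂ i (ℕ.≤-trans (ℕ.m≤n⊔m M₁ M₂) M≤i))

converges-unique : ∀ {X l l′} → X ⟶ l → X ⟶ l′ → l ≋ l′
converges-unique {X} {l} {l′} X→l X→l′ .unwrap ε 0<ε =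
  let N₁ , close₁ = within X→l (half ε) (0<half 0<ε)
      N₂ , close₂ = within X→l′ (half ε) (0<half 0<ε)
      n = N₁ ℕ.⊔ N₂
      M₁ , close₁ = close₁ n (ℕ.m≤m⊔n N₁ N₂)
      M₂ , close₂ = close₂ n (ℕ.m≤n⊔m N₁ N₂)
  in M₁ ℕ.⊔ M₂ , λ i M≤i → ∣p-r∣<ε (seq l i) (seq (X n) i) (seq l′ i)
       (subst (ℚ._< half ε) (∣p-q∣≡∣q-p∣ (seq (X n) i) (seq l i))
         (close₁ i (ℕ.≤-trans (ℕ.m≤m⊔n M₁ M₂) M≤i)))
       (close₂ i (ℕ.≤-trans (ℕ.m≤n⊔m M₁ M₂) M≤i))

lim-cong : ∀ {X Y} cX cY → (∀ n → X n ≋ Y n) → lim X cX ≋ lim Y cY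
lim-cong {X} {Y} cX cY X≋Y = converges-unique
  (converges-shift (λ ε 0<ε → 0 , λ n _ → unwrap (≋-sym (X≋Y n)) ε 0<ε) (lim-converges X cX))
  (lim-converges Y cY)

*-converges : ∀ {X Y l m} → X ⟶ l → Y ⟶ m → (λ n → X n * Y n) ⟶ l * m
*-converges {X} {Y} {l} {m} X→l Y→m .within ε 0<ε =
  let δ , 0<δ , Bδ≡ε = quotient (ℚ.+-mono-< 0<A (0<bound m)) 0<ε
      N₁ , close₁ = within X→l δ 0<δ
      N₂ , close₂ = within Y→m δ 0<δ
      -- Tolerance 1 bounds the late `X n` uniformly, by `bound l` + 1.
      N₃ , close₃ = within X→l 1ℚ (ℚ.positive⁻¹ 1ℚ)
  in N₁ ℕ.⊔ N₂ ℕ.⊔ N₃ , λ n N≤n →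
  let N₁⊔N₂≤n = ℕ.≤-trans (ℕ.m≤m⊔n (N₁ ℕ.⊔ N₂) N₃) N≤n
      M₁ , close₁ = close₁ n (ℕ.≤-trans (ℕ.m≤m⊔n N₁ N₂) N₁⊔N₂≤n)
      M₂ , close₂ = close₂ n (ℕ.≤-trans (ℕ.m≤n⊔m N₁ N₂) N₁⊔N₂≤n)
      M₃ , close₃ = close₃ n (ℕ.≤-trans (ℕ.m≤n⊔m (N₁ ℕ.⊔ N₂) N₃) N≤n)
  in M₁ ℕ.⊔ M₂ ℕ.⊔ M₃ , λ i M≤i →
  let M₁⊔M₂≤i = ℕ.≤-trans (ℕ.m≤m⊔n (M₁ ℕ.⊔ M₂) M₃) M≤i
  in subst (∣ seq (X n) i ℚ.* seq (Y n) i ℚ.- seq l i ℚ.* seq m i ∣ ℚ.<_) Bδ≡ε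
       (∣pq-rt∣< (seq (X n) i) (seq (Y n) i) (seq l i) (seq m i) 0<A (0<bound m)
         (∣X∣≤A n i (close₃ i (ℕ.≤-trans (ℕ.m≤n⊔m (M₁ ℕ.⊔ M₂) M₃) M≤i))) (∣seq∣≤bound m i)
         (close₁ i (ℕ.≤-trans (ℕ.m≤m⊔n M₁ M₂) M₁⊔M₂≤i))
         (close₂ i (ℕ.≤-trans (ℕ.m≤n⊔m M₁ M₂) M₁⊔M₂≤i)))
  where
  A = bound l ℚ.+ 1ℚ
  0<A = ℚ.+-mono-< (0<bound l) (ℚ.positive⁻¹ 1ℚ)
  ∣X∣≤A : ∀ n i → ∣ seq (X n) i ℚ.- seq l i ∣ ℚ.< 1ℚ → ∣ seq (X n) i ∣ ℚ.≤ A
  ∣X∣≤A n i X~l = begin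
    ∣ p ∣                    ≡⟨ cong ∣_∣ (solve 2 (λ p q → p := q :+ (p :- q)) refl p q) ⟩
    ∣ q ℚ.+ (p ℚ.- q) ∣      ≤⟨ ℚ.∣p+q∣≤∣p∣+∣q∣ q (p ℚ.- q) ⟩
    ∣ q ∣ ℚ.+ ∣ p ℚ.- q ∣    ≤⟨ ℚ.+-mono-≤ (∣seq∣≤bound l i) (ℚ.<⇒≤ X~l) ⟩
    A                        ∎
    where
    open ℚ.≤-Reasoning
    open ℚSolver.+-*-Solver
    p = seq (X n) i
    q = seq l i

-- Strict positivity can be lost in a limit, its negation cannot: a gap ε of the limit leaves a gap
-- ε/2 to some late `X n`.
limit-≯0 : ∀ {X l N} → X ⟶ l → (∀ n → N ℕ.≤ n → ¬ X n >0) → ¬ l >0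
limit-≯0 {X} {l} {N} X→l X≯0 (positive ε 0<ε M ε≤l) =
  let N′ , close = within X→l (half ε) (0<half 0<ε)
      n = N ℕ.⊔ N′
      M′ , close = close n (ℕ.m≤n⊔m N N′)
  in X≯0 n (ℕ.m≤m⊔n N N′) (positive (half ε) (0<half 0<ε) (M ℕ.⊔ M′) λ i M≤i →
       half≤ (seq l i) (seq (X n) i) (ε≤l i (ℕ.≤-trans (ℕ.m≤m⊔n M M′) M≤i))
         (subst (ℚ._< half ε) (∣p-q∣≡∣q-p∣ (seq (X n) i) (seq l i))
           (close i (ℕ.≤-trans (ℕ.m≤n⊔m M M′) M≤i))))

sub-converges : ∀ c {X l} → X ⟶ l → (λ n → c - X n) ⟶ c - l
sub-converges c {X} {l} X→l .within ε 0<ε = let N , close = within X→l ε 0<ε in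
  N , λ n N≤n → let M , close = close n N≤n in
  M , λ i M≤i → subst (ℚ._< ε) (eq (seq c i) (seq (X n) i) (seq l i)) (close i M≤i)
  where
  open ℚSolver.+-*-Solver
  eq : ∀ r p q → ∣ p ℚ.- q ∣ ≡ ∣ (r ℚ.- p) ℚ.- (r ℚ.- q) ∣
  eq r p q = trans (∣p-q∣≡∣q-p∣ p q)
    (cong ∣_∣ (solve 3 (λ p q r → q :- p := (r :- p) :- (r :- q)) refl p q r))

-- Exponential series of rationals

module CauchyProduct where

  open ℚSolver.+-*-Solver

  sum : (ℕ → ℚ) → ℕ → ℚ
  sum a zero    = 0ℚ
  sum a (suc n) = sum a n ℚ.+ a n

  -- The coefficient a₀bₙ + ... + aₙb₀ of the product series. Shifting a while keeping b avoids
  -- subtraction of indices.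
  conv : (ℕ → ℚ) → (ℕ → ℚ) → ℕ → ℚ
  conv a b zero    = a 0 ℚ.* b 0
  conv a b (suc n) = a 0 ℚ.* b (suc n) ℚ.+ conv (a ∘ suc) b n

  -- The sum enters as any c pointwise equal to it, because the sequences met later agree only
  -- pointwise.
  conv-+ˡ : ∀ {a a′ c} b → (∀ k → c k ≡ a k ℚ.+ a′ k) → ∀ n → conv c b n ≡ conv a b n ℚ.+ conv a′ b n
  conv-+ˡ {a} {a′} b c≡ zero = trans (cong (ℚ._* b 0) (c≡ 0)) (ℚ.*-distribʳ-+ (b 0) (a 0) (a′ 0))
  conv-+ˡ {a} {a′} b c≡ (suc n) = trans
    (cong₂ (λ p q → p ℚ.* b (suc n) ℚ.+ q) (c≡ 0) (conv-+ˡ b (c≡ ∘ suc) n))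
    (solve 5 (λ a a′ b p q → (a :+ a′) :* b :+ (p :+ q) := (a :* b :+ p) :+ (a′ :* b :+ q)) refl
      (a 0) (a′ 0) (b (suc n)) (conv (a ∘ suc) b n) (conv (a′ ∘ suc) b n))

  conv-*ˡ : ∀ {a c} t b → (∀ k → c k ≡ t ℚ.* a k) → ∀ n → conv c b n ≡ t ℚ.* conv a b n
  conv-*ˡ {a} t b c≡ zero = trans (cong (ℚ._* b 0) (c≡ 0)) (ℚ.*-assoc t (a 0) (b 0))
  conv-*ˡ {a} t b c≡ (suc n) = trans
    (cong₂ (λ p q → p ℚ.* b (suc n) ℚ.+ q) (c≡ 0) (conv-*ˡ t b (c≡ ∘ suc) n))
    (solve 4 (λ t a b p → (t :* a) :* b :+ t :* p := t :* (a :* b :+ p)) refl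
      t (a 0) (b (suc n)) (conv (a ∘ suc) b n))

  conv-*ʳ : ∀ {b c} t a → (∀ k → c k ≡ t ℚ.* b k) → ∀ n → conv a c n ≡ t ℚ.* conv a b n
  conv-*ʳ {b} t a c≡ zero = trans (cong (a 0 ℚ.*_) (c≡ 0))
    (solve 3 (λ t a b → a :* (t :* b) := t :* (a :* b)) refl t (a 0) (b 0))
  conv-*ʳ {b} t a c≡ (suc n) = trans
    (cong₂ (λ p q → a 0 ℚ.* p ℚ.+ q) (c≡ (suc n)) (conv-*ʳ t (a ∘ suc) c≡ n))
    (solve 4 (λ t a b p → a :* (t :* b) :+ t :* p := t :* (a :* b :+ p)) refl
      t (a 0) (b (suc n)) (conv (a ∘ suc) b n))

  -- The derivative of the power series with coefficients a
  δ : (ℕ → ℚ) → ℕ → ℚ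
  δ a k = fromℕ (suc k) ℚ.* a (suc k)

  -- The product rule for power series. The recursion shifts a, and `δ` fails to commute with the
  -- shift by one extra copy of the coefficient; that copy matches the 1 in n + 2 = 1 + (n + 1).
  leibniz : ∀ a b n → δ (conv a b) n ≡ conv (δ a) b n ℚ.+ conv a (δ b) n
  leibniz a b zero = solve 5 (λ f a₀ a₁ b₀ b₁ →
      f :* (a₀ :* b₁ :+ a₁ :* b₀) := (f :* a₁) :* b₀ :+ a₀ :* (f :* b₁)) refl
    (fromℕ 1) (a 0) (a 1) (b 0) (b 1)
  leibniz a b (suc n) = begin
    F ℚ.* (a₀ ℚ.* b₂ ℚ.+ (a₁ ℚ.* b₁ ℚ.+ C))
      ≡⟨ cong (λ f → f ℚ.* (a₀ ℚ.* b₂ ℚ.+ (a₁ ℚ.* b₁ ℚ.+ C))) (fromℕ-suc (suc n)) ⟩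
    (1ℚ ℚ.+ G) ℚ.* (a₀ ℚ.* b₂ ℚ.+ (a₁ ℚ.* b₁ ℚ.+ C))
      ≡⟨ solve 6 (λ a₀ a₁ b₁ b₂ G C → (con 1ℚ :+ G) :* (a₀ :* b₂ :+ (a₁ :* b₁ :+ C)) :=
           (a₁ :* b₁ :+ C :+ a₀ :* ((con 1ℚ :+ G) :* b₂)) :+ G :* (a₁ :* b₁ :+ C)) refl a₀ a₁ b₁ b₂ G C ⟩
    (a₁ ℚ.* b₁ ℚ.+ C ℚ.+ a₀ ℚ.* ((1ℚ ℚ.+ G) ℚ.* b₂)) ℚ.+ δ (conv (a ∘ suc) b) n
      ≡⟨ cong₂ (λ f p → (a₁ ℚ.* b₁ ℚ.+ C ℚ.+ a₀ ℚ.* (f ℚ.* b₂)) ℚ.+ p)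
           (sym (fromℕ-suc (suc n))) (leibniz (a ∘ suc) b n) ⟩
    (a₁ ℚ.* b₁ ℚ.+ C ℚ.+ a₀ ℚ.* (F ℚ.* b₂)) ℚ.+ (P ℚ.+ Q)
      -- The factor `con 1ℚ` is `fromℕ 1`, which turns the first product into `δ a 0` times `b₁` by
      -- computation.
      ≡⟨ solve 6 (λ a₁ b₁ C R P Q → (a₁ :* b₁ :+ C :+ R) :+ (P :+ Q) :=
           ((con 1ℚ :* a₁) :* b₁ :+ (P :+ C)) :+ (R :+ Q)) refl a₁ b₁ C (a₀ ℚ.* (F ℚ.* b₂)) P Q ⟩
    (δ a 0 ℚ.* b₁ ℚ.+ (P ℚ.+ C)) ℚ.+ (a₀ ℚ.* (F ℚ.* b₂) ℚ.+ Q)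
      ≡⟨ cong (λ p → (δ a 0 ℚ.* b₁ ℚ.+ p) ℚ.+ (a₀ ℚ.* (F ℚ.* b₂) ℚ.+ Q))
           (sym (conv-+ˡ b δ-shift n)) ⟩
    conv (δ a) b (suc n) ℚ.+ conv a (δ b) (suc n) ∎
    where
    open ≡-Reasoning
    F = fromℕ (suc (suc n))
    G = fromℕ (suc n)
    a₀ = a 0
    a₁ = a 1
    b₁ = b (suc n)
    b₂ = b (suc (suc n))
    C = conv (λ k → a (suc (suc k))) b n
    P = conv (δ (a ∘ suc)) b n
    Q = conv (a ∘ suc) (δ b) n
    δ-shift : ∀ k → δ a (suc k) ≡ δ (a ∘ suc) k ℚ.+ a (suc (suc k))
    δ-shift k = trans (cong (ℚ._* a (suc (suc k))) (fromℕ-suc (suc k)))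
      (solve 2 (λ f a → (con 1ℚ :+ f) :* a := f :* a :+ a) refl (fromℕ (suc k)) (a (suc (suc k))))

  expTerm : ℚ → ℕ → ℚ
  expTerm p k = 1/! k ℚ.* pow p k

  δ-expTerm : ∀ p k → δ (expTerm p) k ≡ p ℚ.* expTerm p k
  δ-expTerm p k = trans
    (solve 4 (λ f e p P → f :* (e :* (p :* P)) := p :* ((e :* f) :* P)) refl
      (fromℕ (suc k)) (1/! (suc k)) p (pow p k))
    (cong (λ e → p ℚ.* (e ℚ.* pow p k)) (1/!-suc k))

  *-cancelˡ-≡-pos : ∀ {r p q} → 0ℚ ℚ.< r → r ℚ.* p ≡ r ℚ.* q → p ≡ q
  *-cancelˡ-≡-pos {r} 0<r eq = ℚ.≤-antisym
    (ℚ.*-cancelˡ-≤-pos r (ℚ.≤-reflexive eq)) (ℚ.*-cancelˡ-≤-pos r (ℚ.≤-reflexive (sym eq)))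
    where instance _ = ℚ.positive 0<r

  -- The binomial theorem: both sides solve δ c = (p + q) c.
  conv-expTerm : ∀ p q n → conv (expTerm p) (expTerm q) n ≡ expTerm (p ℚ.+ q) n
  conv-expTerm p q zero    = refl
  conv-expTerm p q (suc n) = *-cancelˡ-≡-pos (0<fromℕ-suc n) (begin
    δ (conv (expTerm p) (expTerm q)) n
      ≡⟨ leibniz (expTerm p) (expTerm q) n ⟩
    conv (δ (expTerm p)) (expTerm q) n ℚ.+ conv (expTerm p) (δ (expTerm q)) n
      ≡⟨ cong₂ ℚ._+_ (conv-*ˡ p (expTerm q) (δ-expTerm p) n) (conv-*ʳ q (expTerm p) (δ-expTerm q) n) ⟩
    p ℚ.* C ℚ.+ q ℚ.* C
      ≡⟨ ℚ.*-distribʳ-+ C p q ⟨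
    (p ℚ.+ q) ℚ.* C
      ≡⟨ cong ((p ℚ.+ q) ℚ.*_) (conv-expTerm p q n) ⟩
    (p ℚ.+ q) ℚ.* expTerm (p ℚ.+ q) n
      ≡⟨ δ-expTerm (p ℚ.+ q) n ⟨
    δ (expTerm (p ℚ.+ q)) n ∎)
    where
    open ≡-Reasoning
    C = conv (expTerm p) (expTerm q) n

  sum-suc : ∀ a n → sum a (suc n) ≡ a 0 ℚ.+ sum (a ∘ suc) n
  sum-suc a zero    = ℚ.+-comm 0ℚ (a 0)
  sum-suc a (suc n) = trans (cong (ℚ._+ a (suc n)) (sum-suc a n))
    (ℚ.+-assoc (a 0) (sum (a ∘ suc) n) (a (suc n)))

  -- The triangle i + j ≤ n is split into its row i = 0 and the smaller triangle for the shifted a.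
  sum-conv-suc : ∀ a b n →
    sum (conv a b) (suc n) ≡ a 0 ℚ.* sum b (suc n) ℚ.+ sum (conv (a ∘ suc) b) n
  sum-conv-suc a b zero    = solve 2 (λ a b → con 0ℚ :+ a :* b := a :* (con 0ℚ :+ b) :+ con 0ℚ) refl (a 0) (b 0)
  sum-conv-suc a b (suc n) = trans
    (cong (ℚ._+ conv a b (suc n)) (sum-conv-suc a b n))
    (solve 5 (λ a B b S c → (a :* B :+ S) :+ (a :* b :+ c) := a :* (B :+ b) :+ (S :+ c)) refl
      (a 0) (sum b (suc n)) (b (suc n)) (sum (conv (a ∘ suc) b) n) (conv (a ∘ suc) b n))

  sum-conv-nonNeg : ∀ {a b} → (∀ k → 0ℚ ℚ.≤ a k) → (∀ k → 0ℚ ℚ.≤ b k) → ∀ n → 0ℚ ℚ.≤ sum (conv a b) n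
  sum-conv-nonNeg {a} {b} 0≤a 0≤b zero    = ℚ.≤-refl
  sum-conv-nonNeg {a} {b} 0≤a 0≤b (suc n) = +-nonNeg (sum-conv-nonNeg 0≤a 0≤b n) (conv-nonNeg 0≤a n)
    where
    conv-nonNeg : ∀ {a} → (∀ k → 0ℚ ℚ.≤ a k) → ∀ n → 0ℚ ℚ.≤ conv a b n
    conv-nonNeg 0≤a zero    = *-nonNeg (0≤a 0) (0≤b 0)
    conv-nonNeg 0≤a (suc n) = +-nonNeg (*-nonNeg (0≤a 0) (0≤b (suc n))) (conv-nonNeg (0≤a ∘ suc) n)

  ∣tail∣≤ : ∀ {b β} → (∀ k → ∣ b k ∣ ℚ.≤ β k) → ∀ {m n} → m ℕ.≤′ n →
    ∣ sum b n ℚ.- sum b m ∣ ℚ.≤ sum β n ℚ.- sum β m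
  ∣tail∣≤ {b} {β} b≤β {m} ℕ.≤′-refl = ℚ.≤-reflexive
    (trans (cong ∣_∣ (ℚ.+-inverseʳ (sum b m))) (sym (ℚ.+-inverseʳ (sum β m))))
  ∣tail∣≤ {b} {β} b≤β {m} {suc n} (ℕ.≤′-step m≤n) = begin
    ∣ (B ℚ.+ b n) ℚ.- B₀ ∣          ≡⟨ cong ∣_∣ (eq B (b n) B₀) ⟩
    ∣ (B ℚ.- B₀) ℚ.+ b n ∣          ≤⟨ ℚ.∣p+q∣≤∣p∣+∣q∣ (B ℚ.- B₀) (b n) ⟩
    ∣ B ℚ.- B₀ ∣ ℚ.+ ∣ b n ∣        ≤⟨ ℚ.+-mono-≤ (∣tail∣≤ {b} {β} b≤β m≤n) (b≤β n) ⟩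
    (sum β n ℚ.- sum β m) ℚ.+ β n   ≡⟨ eq (sum β n) (β n) (sum β m) ⟨
    (sum β n ℚ.+ β n) ℚ.- sum β m   ∎
    where
    open ℚ.≤-Reasoning
    B = sum b n
    B₀ = sum b m
    eq : ∀ p q r → (p ℚ.+ q) ℚ.- r ≡ (p ℚ.- r) ℚ.+ q
    eq = solve 3 (λ p q r → (p :+ q) :- r := (p :- r) :+ q) refl

  -- The terms of (Σ a)(Σ b) missing from the Cauchy product are dominated by
  -- the corresponding terms of (Σ α)(Σ β).
  ∣sum*sum-sum-conv∣≤ : ∀ {a b α β} → (∀ k → ∣ a k ∣ ℚ.≤ α k) → (∀ k → ∣ b k ∣ ℚ.≤ β k) →
    ∀ n {N} → n ℕ.≤ N →
    ∣ sum a n ℚ.* sum b N ℚ.- sum (conv a b) n ∣ ℚ.≤ sum α n ℚ.* sum β N ℚ.- sum (conv α β) n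
  ∣sum*sum-sum-conv∣≤ {b = b} {β = β} a≤α b≤β zero {N} _ = ℚ.≤-reflexive
    (trans (cong ∣_∣ (eq (sum b N))) (sym (eq (sum β N))))
    where
    eq : ∀ p → 0ℚ ℚ.* p ℚ.- 0ℚ ≡ 0ℚ
    eq = solve 1 (λ p → con 0ℚ :* p :- con 0ℚ := con 0ℚ) refl
  ∣sum*sum-sum-conv∣≤ {a} {b} {α} {β} a≤α b≤β (suc n) {N} n<N = begin
    ∣ sum a (suc n) ℚ.* sum b N ℚ.- sum (conv a b) (suc n) ∣
      ≡⟨ cong ∣_∣ (split a b) ⟩
    ∣ a 0 ℚ.* (sum b N ℚ.- sum b (suc n)) ℚ.+ R ∣
      ≤⟨ ℚ.∣p+q∣≤∣p∣+∣q∣ (a 0 ℚ.* (sum b N ℚ.- sum b (suc n))) R ⟩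
    ∣ a 0 ℚ.* (sum b N ℚ.- sum b (suc n)) ∣ ℚ.+ ∣ R ∣
      ≡⟨ cong (ℚ._+ ∣ R ∣) (ℚ.∣p*q∣≡∣p∣*∣q∣ (a 0) (sum b N ℚ.- sum b (suc n))) ⟩
    ∣ a 0 ∣ ℚ.* ∣ sum b N ℚ.- sum b (suc n) ∣ ℚ.+ ∣ R ∣
      ≤⟨ ℚ.+-mono-≤
           (*-mono-≤ (ℚ.0≤∣p∣ (a 0)) (ℚ.≤-trans (ℚ.0≤∣p∣ (sum b N ℚ.- sum b (suc n))) tail≤) (a≤α 0) tail≤)
           (∣sum*sum-sum-conv∣≤ (a≤α ∘ suc) b≤β n (ℕ.<⇒≤ n<N)) ⟩
    α 0 ℚ.* (sum β N ℚ.- sum β (suc n)) ℚ.+ (sum (α ∘ suc) n ℚ.* sum β N ℚ.- sum (conv (α ∘ suc) β) n)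
      ≡⟨ split α β ⟨
    sum α (suc n) ℚ.* sum β N ℚ.- sum (conv α β) (suc n) ∎
    where
    open ℚ.≤-Reasoning
    R = sum (a ∘ suc) n ℚ.* sum b N ℚ.- sum (conv (a ∘ suc) b) n
    tail≤ = ∣tail∣≤ {b} {β} b≤β (ℕ.≤⇒≤′ n<N)
    split : ∀ a b → sum a (suc n) ℚ.* sum b N ℚ.- sum (conv a b) (suc n) ≡
      a 0 ℚ.* (sum b N ℚ.- sum b (suc n)) ℚ.+ (sum (a ∘ suc) n ℚ.* sum b N ℚ.- sum (conv (a ∘ suc) b) n)
    split a b = trans
      (cong₂ (λ p q → p ℚ.* sum b N ℚ.- q) (sum-suc a n) (sum-conv-suc a b n))
      (solve 5 (λ a S B b T → (a :+ S) :* B :- (a :* b :+ T) := a :* (B :- b) :+ (S :* B :- T)) refl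
        (a 0) (sum (a ∘ suc) n) (sum b N) (sum b (suc n)) (sum (conv (a ∘ suc) b) n))

  sum-mono : ∀ {b} → (∀ k → 0ℚ ℚ.≤ b k) → ∀ {m n} → m ℕ.≤′ n → sum b m ℚ.≤ sum b n
  sum-mono 0≤b ℕ.≤′-refl = ℚ.≤-refl
  sum-mono {b} 0≤b {n = suc n} (ℕ.≤′-step m≤n) = ℚ.≤-trans (sum-mono 0≤b m≤n) (x≤x+y (sum b n) (0≤b n))

  -- The rectangle i < m, j < n lies in the triangle i + j < m + n, and the terms are nonnegative.
  sum*sum≤sum-conv : ∀ {a b} → (∀ k → 0ℚ ℚ.≤ a k) → (∀ k → 0ℚ ℚ.≤ b k) →
    ∀ m n → sum a m ℚ.* sum b n ℚ.≤ sum (conv a b) (m ℕ.+ n)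
  sum*sum≤sum-conv {a} {b} 0≤a 0≤b zero n = subst (ℚ._≤ sum (conv a b) n)
    (sym (ℚ.*-zeroˡ (sum b n))) (sum-conv-nonNeg 0≤a 0≤b n)
  sum*sum≤sum-conv {a} {b} 0≤a 0≤b (suc m) n = begin
    sum a (suc m) ℚ.* sum b n
      ≡⟨ cong (ℚ._* sum b n) (sum-suc a m) ⟩
    (a 0 ℚ.+ sum (a ∘ suc) m) ℚ.* sum b n
      ≡⟨ ℚ.*-distribʳ-+ (sum b n) (a 0) (sum (a ∘ suc) m) ⟩
    a 0 ℚ.* sum b n ℚ.+ sum (a ∘ suc) m ℚ.* sum b n
      ≤⟨ ℚ.+-mono-≤
           (ℚ.*-monoˡ-≤-nonNeg (a 0) {{ℚ.nonNegative (0≤a 0)}}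
             (sum-mono 0≤b (ℕ.≤⇒≤′ (ℕ.m≤n+m n (suc m)))))
           (sum*sum≤sum-conv (0≤a ∘ suc) 0≤b m n) ⟩
    a 0 ℚ.* sum b (suc m ℕ.+ n) ℚ.+ sum (conv (a ∘ suc) b) (m ℕ.+ n)
      ≡⟨ sum-conv-suc a b (m ℕ.+ n) ⟨
    sum (conv a b) (suc m ℕ.+ n) ∎
    where open ℚ.≤-Reasoning

  ∣pow∣≤ : ∀ {p M} → ∣ p ∣ ℚ.≤ M → ∀ k → ∣ pow p k ∣ ℚ.≤ pow M k
  ∣pow∣≤ p≤M zero = ℚ.≤-refl
  ∣pow∣≤ {p} {M} p≤M (suc k) = subst (ℚ._≤ M ℚ.* pow M k) (sym (ℚ.∣p*q∣≡∣p∣*∣q∣ p (pow p k)))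
    (*-mono-≤ (ℚ.0≤∣p∣ p) (0≤pow (ℚ.≤-trans (ℚ.0≤∣p∣ p) p≤M) k) p≤M (∣pow∣≤ p≤M k))

  ∣expTerm∣≤ : ∀ {p M} → ∣ p ∣ ℚ.≤ M → ∀ k → ∣ expTerm p k ∣ ℚ.≤ expTerm M k
  ∣expTerm∣≤ {p} {M} p≤M k = subst (ℚ._≤ expTerm M k)
    (sym (trans (ℚ.∣p*q∣≡∣p∣*∣q∣ (1/! k) (pow p k)) (cong (ℚ._* ∣ pow p k ∣) (ℚ.0≤p⇒∣p∣≡p (0≤1/! k)))))
    (ℚ.*-monoˡ-≤-nonNeg (1/! k) {{ℚ.nonNegative (0≤1/! k)}} (∣pow∣≤ p≤M k))

  partial≡sum : ∀ p n → partial (pow p) n ≡ sum (expTerm p) n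
  partial≡sum p zero    = refl
  partial≡sum p (suc n) = cong (ℚ._+ expTerm p n) (partial≡sum p n)

  sum-cong : ∀ {a b} → (∀ k → a k ≡ b k) → ∀ n → sum a n ≡ sum b n
  sum-cong a≡b zero    = refl
  sum-cong a≡b (suc n) = cong₂ ℚ._+_ (sum-cong a≡b n) (a≡b n)

  sum-conv≡partial : ∀ p q n → sum (conv (expTerm p) (expTerm q)) n ≡ partial (pow (p ℚ.+ q)) n
  sum-conv≡partial p q n = trans (sum-cong (conv-expTerm p q) n) (sym (partial≡sum (p ℚ.+ q) n))

  -- N depends on M and ε alone, so that p and q may run through all terms of two Cauchy sequences.
  -- Domination replaces both by M; the square of side n then fits into the triangle of side 2n, and
  -- a tail of the series of M + M remains.
  partial-+ : ∀ M → 0ℚ ℚ.≤ M → ∀ ε → 0ℚ ℚ.< ε → ∃[ N ] ∀ p q → ∣ p ∣ ℚ.≤ M → ∣ q ∣ ℚ.≤ M →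
    ∀ n → N ℕ.≤ n → ∣ partial (pow p) n ℚ.* partial (pow q) n ℚ.- partial (pow (p ℚ.+ q)) n ∣ ℚ.< ε
  partial-+ M 0≤M ε 0<ε = N , λ p q p≤M q≤M n N≤n → begin-strict
    ∣ partial (pow p) n ℚ.* partial (pow q) n ℚ.- partial (pow (p ℚ.+ q)) n ∣
      ≡⟨ cong₂ (λ x y → ∣ x ℚ.- y ∣) (cong₂ ℚ._*_ (partial≡sum p n) (partial≡sum q n))
           (sym (sum-conv≡partial p q n)) ⟩
    ∣ sum (expTerm p) n ℚ.* sum (expTerm q) n ℚ.- sum (conv (expTerm p) (expTerm q)) n ∣
      ≤⟨ ∣sum*sum-sum-conv∣≤ (∣expTerm∣≤ p≤M) (∣expTerm∣≤ q≤M) n ℕ.≤-refl ⟩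
    sum (expTerm M) n ℚ.* sum (expTerm M) n ℚ.- sum (conv (expTerm M) (expTerm M)) n
      ≤⟨ ℚ.+-monoˡ-≤ (ℚ.- sum (conv (expTerm M) (expTerm M)) n)
           (sum*sum≤sum-conv 0≤expTerm 0≤expTerm n n) ⟩
    sum (conv (expTerm M) (expTerm M)) (n ℕ.+ n) ℚ.- sum (conv (expTerm M) (expTerm M)) n
      ≡⟨ cong₂ ℚ._-_ (sum-conv≡partial M M (n ℕ.+ n)) (sum-conv≡partial M M n) ⟩
    partial (pow (M ℚ.+ M)) (n ℕ.+ n) ℚ.- partial (pow (M ℚ.+ M)) n
      ≤⟨ p≤∣p∣ (partial (pow (M ℚ.+ M)) (n ℕ.+ n) ℚ.- partial (pow (M ℚ.+ M)) n) ⟩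
    ∣ partial (pow (M ℚ.+ M)) (n ℕ.+ n) ℚ.- partial (pow (M ℚ.+ M)) n ∣
      <⟨ proj₂ uc (pow (M ℚ.+ M)) (∣pow∣≤ (ℚ.≤-reflexive (ℚ.0≤p⇒∣p∣≡p 0≤2M)))
           (n ℕ.+ n) n (ℕ.≤-trans N≤n (ℕ.m≤m+n n n)) N≤n ⟩
    ε ∎
    where
    open ℚ.≤-Reasoning
    0≤2M = +-nonNeg 0≤M 0≤M
    uc = ExpTail.uniformly-cauchy (M ℚ.+ M) 0≤2M ε 0<ε
    N = proj₁ uc
    0≤expTerm : ∀ k → 0ℚ ℚ.≤ expTerm M k
    0≤expTerm k = *-nonNeg (0≤1/! k) (0≤pow 0≤M k)

open CauchyProduct using (partial-+)

open ℝSolver using (solve; _:=_; _:+_; _:-_; _:*_; :-_; con)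

-- Signs, zero products, finite sums and products

+-congˡ : ∀ {x y y′} → y ≋ y′ → x + y ≋ x + y′
+-congˡ = +-cong ≋-refl

+-congʳ : ∀ {x x′ y} → x ≋ x′ → x + y ≋ x′ + y
+-congʳ x≋x′ = +-cong x≋x′ ≋-refl

*-congˡ : ∀ {x y y′} → y ≋ y′ → x * y ≋ x * y′
*-congˡ = *-cong ≋-refl

*-congʳ : ∀ {x x′ y} → x ≋ x′ → x * y ≋ x′ * y
*-congʳ x≋x′ = *-cong x≋x′ ≋-refl

0<⇒>0 : ∀ {x} → 0ℝ < x → x >0
0<⇒>0 {x} 0<x = >0-cong (solve 1 (λ x → x :- con 0ℚ := x) ≋-refl x) (<⇒>0 0ℝ x 0<x)

>0⇒0< : ∀ {x} → x >0 → 0ℝ < x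
>0⇒0< {x} x>0 = >0⇒< (>0-cong (solve 1 (λ x → x := x :- con 0ℚ) ≋-refl x) x>0)

>0-asym : ∀ {x y} → x + y ≋ 0ℝ → x >0 → ¬ y >0
>0-asym x+y≋0 x>0 y>0 = ≋0⇒≯0 x+y≋0 (+->0 x>0 y>0)

neg-≋0 : ∀ {x} → x ≋ 0ℝ → - x ≋ 0ℝ
neg-≋0 x≋0 = ≋-trans (-‿cong x≋0) (solve 0 (:- con 0ℚ := con 0ℚ) ≋-refl)

-- Being nonzero is only a negation here and gives no inverse of x. Instead, a positive y would
-- exclude both signs of x and so force x to vanish.
*≋0 : ∀ {x y} → x * y ≋ 0ℝ → ¬ x ≋ 0ℝ → y ≋ 0ℝ
*≋0 {x} {y} xy≋0 x≉0 = ≯0⇒≋0 y (y≯0 xy≋0)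
  (y≯0 (≋-trans (solve 2 (λ x y → x :* :- y := :- (x :* y)) ≋-refl x y) (neg-≋0 xy≋0)))
  where
  -- Quantified over y anew, to be applied to - y too.
  y≯0 : ∀ {y} → x * y ≋ 0ℝ → ¬ y >0
  y≯0 {y} xy≋0 y>0 = x≉0 (≯0⇒≋0 x
    (λ x>0 → ≋0⇒≯0 xy≋0 (*->0 x>0 y>0))
    (λ -x>0 → ≋0⇒≯0
      (≋-trans (solve 2 (λ x y → (:- x) :* y := :- (x :* y)) ≋-refl x y) (neg-≋0 xy≋0))
      (*->0 -x>0 y>0)))

∑-cong : ∀ {n} {f g : Vector ℝ n} → (∀ i → f i ≋ g i) → ∑ f ≋ ∑ g
∑-cong {zero}  f≋g = ≋-refl
∑-cong {suc n} f≋g = +-cong (f≋g zero) (∑-cong λ i → f≋g (suc i))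

∏-cong : ∀ {n} {f g : Vector ℝ n} → (∀ i → f i ≋ g i) → ∏ f ≋ ∏ g
∏-cong {zero}  f≋g = ≋-refl
∏-cong {suc n} f≋g = *-cong (f≋g zero) (∏-cong λ i → f≋g (suc i))

∑≋0 : ∀ {n} {f : Vector ℝ n} → (∀ i → f i ≋ 0ℝ) → ∑ f ≋ 0ℝ
∑≋0 {zero}  f≋0 = ≋-refl
∑≋0 {suc n} f≋0 = ≋-trans (+-cong (f≋0 zero) (∑≋0 λ i → f≋0 (suc i)))
  (solve 0 (con 0ℚ :+ con 0ℚ := con 0ℚ) ≋-refl)

∑-identity : ∀ {n} i (v : Vector ℝ n) → ∑ (λ j → identity i j * v j) ≋ v i
∑-identity zero v = ≋-trans
  (+-congˡ (∑≋0 λ j → solve 1 (λ x → con 0ℚ :* x := con 0ℚ) ≋-refl (v (suc j))))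
  (solve 1 (λ x → con 1ℚ :* x :+ con 0ℚ := x) ≋-refl (v zero))
∑-identity (suc i) v = ≋-trans
  (+-congˡ (∑-identity i (v ∘ suc)))
  (solve 2 (λ x y → con 0ℚ :* x :+ y := y) ≋-refl (v zero) (v (suc i)))

∏-factor≋0 : ∀ {n} {f : Vector ℝ n} i → f i ≋ 0ℝ → ∏ f ≋ 0ℝ
∏-factor≋0 {f = f} zero f≋0 = ≋-trans (*-congʳ f≋0)
  (solve 1 (λ x → con 0ℚ :* x := con 0ℚ) ≋-refl (∏ (f ∘ suc)))
∏-factor≋0 {f = f} (suc i) f≋0 = ≋-trans (*-congˡ (∏-factor≋0 i f≋0))
  (solve 1 (λ x → x :* con 0ℚ := con 0ℚ) ≋-refl (f zero))

-- The vanishing factor cannot be located constructively; the double negation suffices for deriving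
-- contradictions.
∏≋0⇒¬¬∃ : ∀ {n} {f : Vector ℝ n} → ∏ f ≋ 0ℝ → ¬ (∀ i → ¬ f i ≋ 0ℝ)
∏≋0⇒¬¬∃ {zero}  1≋0  _   = ≋0⇒≯0 1≋0 1>0
∏≋0⇒¬¬∃ {suc n} ∏≋0 f≉0 = ∏≋0⇒¬¬∃ (*≋0 ∏≋0 (f≉0 zero)) (f≉0 ∘ suc)

x≋y⇒x-y≋0 : ∀ {x y} → x ≋ y → x - y ≋ 0ℝ
x≋y⇒x-y≋0 {x} {y} x≋y = ≋-trans (+-congʳ x≋y) (solve 1 (λ y → y :- y := con 0ℚ) ≋-refl y)

x-y≋0⇒x≋y : ∀ {x y} → x - y ≋ 0ℝ → x ≋ y
x-y≋0⇒x≋y {x} {y} eq = ≋-trans (solve 2 (λ x y → x := (x :- y) :+ y) ≋-refl x y)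
  (≋-trans (+-congʳ eq) (solve 1 (λ y → con 0ℚ :+ y := y) ≋-refl y))

-- Another list of eigenvalues has the same roots, so it contains (up to ¬¬)
-- both μ i and μ j.
distinct-positive-eigenvalues : ∀ {n} (A : Matrix n) μ → HasEigenvalues A μ →
  ∀ i j → μ i >0 → μ j >0 → μ i - μ j >0 → ¬ AtMostOnePositiveEigenvalue A
distinct-positive-eigenvalues A μ eigen i j μi>0 μj>0 μi-μj>0 (μ′ , eigen′ , unique) =
  ∏≋0⇒¬¬∃ (root i) λ k μi≋ → ∏≋0⇒¬¬∃ (root j) λ l μj≋ →
    let μi≋μ′k = x-y≋0⇒x≋y μi≋
        μj≋μ′l = x-y≋0⇒x≋y μj≋
        k≡l = unique k l (>0⇒0< (>0-cong μi≋μ′k μi>0)) (>0⇒0< (>0-cong μj≋μ′l μj>0))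
    in ≋0⇒≯0 (x≋y⇒x-y≋0 (≋-trans μi≋μ′k (≋-trans (subst (λ m → μ′ k ≋ μ′ m) k≡l ≋-refl) (≋-sym μj≋μ′l)))) μi-μj>0
  where
  evaluate : ∀ ν → HasEigenvalues A ν → ∀ x → det (λ i j → x * identity i j - A i j) ≋ ∏ (λ k → x - ν k)
  evaluate ν eigen x = wrap (eigen x)
  root : ∀ i → ∏ (λ k → μ i - μ′ k) ≋ 0ℝ
  root i = ≋-trans (≋-sym (evaluate μ′ eigen′ (μ i)))
    (≋-trans (evaluate μ eigen (μ i)) (∏-factor≋0 {f = λ k → μ i - μ k} i (x≋y⇒x-y≋0 ≋-refl)))

-- The exponential function

seq-partialSum : ∀ x n i → seq (partialSum (x ^_) n) i ≡ partial (pow (seq x i)) n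
seq-partialSum x zero    i = refl
seq-partialSum x (suc n) i = cong₂ (λ p q → p ℚ.+ 1/! n ℚ.* q) (seq-partialSum x n i) (seq-^ n)
  where
  seq-^ : ∀ k → seq (x ^ k) i ≡ pow (seq x i) k
  seq-^ zero    = refl
  seq-^ (suc k) = cong (seq x i ℚ.*_) (seq-^ k)

exp-converges : ∀ x → partialSum (x ^_) ⟶ exp x
exp-converges x = lim-converges (partialSum (x ^_)) (partialSum-cauchy (x ^_) (powers-bounded x))

-- The products of partial sums converge to the left side; by `partial-+`, at every index at once,
-- they also approach the partial sums for x + y. Limits are unique.
exp-+ : ∀ x y → exp x * exp y ≋ exp (x + y)
exp-+ x y = converges-unique (*-converges (exp-converges x) (exp-converges y))
  (converges-shift close (exp-converges (x + y)))
  where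
  M = bound x ℚ.+ bound y
  0≤M = +-nonNeg (ℚ.<⇒≤ (0<bound x)) (ℚ.<⇒≤ (0<bound y))
  x≤M : ∀ i → ∣ seq x i ∣ ℚ.≤ M
  x≤M i = ℚ.≤-trans (∣seq∣≤bound x i) (x≤x+y (bound x) (ℚ.<⇒≤ (0<bound y)))
  y≤M : ∀ i → ∣ seq y i ∣ ℚ.≤ M
  y≤M i = ℚ.≤-trans (∣seq∣≤bound y i)
    (subst (bound y ℚ.≤_) (ℚ.+-comm (bound y) (bound x)) (x≤x+y (bound y) (ℚ.<⇒≤ (0<bound x))))
  close : ∀ ε → 0ℚ ℚ.< ε → ∃[ N ] ∀ n → N ℕ.≤ n →
    Within ε (partialSum (x ^_) n * partialSum (y ^_) n) (partialSum ((x + y) ^_) n)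
  close ε 0<ε = let N , small = partial-+ M 0≤M ε 0<ε in
    N , λ n N≤n → 0 , λ i _ → subst (ℚ._< ε)
      (sym (cong₂ (λ p q → ∣ p ℚ.- q ∣)
        (cong₂ ℚ._*_ (seq-partialSum x n i) (seq-partialSum y n i))
        (seq-partialSum (x + y) n i)))
      (small (seq x i) (seq y i) (x≤M i) (y≤M i) n N≤n)

exp-cong : ∀ {x y} → x ≋ y → exp x ≋ exp y
exp-cong {x} {y} x≋y = lim-cong _ _ partialSum-cong
  where
  ^-cong : ∀ k → x ^ k ≋ y ^ k
  ^-cong zero    = ≋-refl
  ^-cong (suc k) = *-cong x≋y (^-cong k)
  partialSum-cong : ∀ n → partialSum (x ^_) n ≋ partialSum (y ^_) n
  partialSum-cong zero    = ≋-refl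
  partialSum-cong (suc n) = +-cong (partialSum-cong n) (*-congˡ (^-cong n))

expSeries-constant : ∀ a bounded {c} → a 0 ≋ c → (∀ k → a (suc k) ≋ 0ℝ) → expSeries a bounded ≋ c
expSeries-constant a bounded {c} a₀≋c a₊≋0 = converges-unique
  (lim-converges (partialSum a) (partialSum-cauchy a bounded))
  -- From 1 on, because `partialSum a 0` is the empty sum.
  (converges λ ε 0<ε → 1 , λ where (suc n) _ → unwrap (partialSum≋c n) ε 0<ε)
  where
  partialSum≋c : ∀ n → partialSum a (suc n) ≋ c
  partialSum≋c zero = ≋-trans (+-congˡ (*-congˡ a₀≋c))
    (solve 1 (λ c → con 0ℚ :+ con 1ℚ :* c := c) ≋-refl c)
  partialSum≋c (suc n) = ≋-trans (+-cong (partialSum≋c n) (*-congˡ (a₊≋0 n)))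
    (solve 2 (λ c e → c :+ e :* con 0ℚ := c) ≋-refl c (fromℚ (1/! (suc n))))

expᴹ≋identity : ∀ {n} (A : Matrix n) → (∀ i j → A i j ≋ 0ℝ) → ∀ i j → expᴹ A i j ≋ identity i j
expᴹ≋identity A A≋0 i j = expSeries-constant (λ k → (A ^ᴹ k) i j) (matrix-powers-bounded A i j) ≋-refl
  λ k → ∑≋0 {f = λ m → A i m * (A ^ᴹ k) m j} λ m → ≋-trans (*-congʳ (A≋0 i m))
    (solve 1 (λ x → con 0ℚ :* x := con 0ℚ) ≋-refl ((A ^ᴹ k) m j))

exp-0 : ∀ {x} → x ≋ 0ℝ → exp x ≋ 1ℝ
exp-0 {x} x≋0 = expSeries-constant (x ^_) (powers-bounded x) ≋-refl λ k →
  ≋-trans (*-congʳ x≋0) (solve 1 (λ p → con 0ℚ :* p := con 0ℚ) ≋-refl (x ^ k))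

-- The sum of the first two terms is exactly 1 + x, hence N = 2, and all later terms are positive.
exp≥1+ : ∀ {x} → x >0 → ¬ (1ℝ + x) - exp x >0
exp≥1+ {x} x>0 = limit-≯0 {N = 2} (sub-converges (1ℝ + x) (exp-converges x))
  λ where
    (suc zero) (s≤s ())
    (suc (suc n)) _ → partialSum≥ n
  where
  S = partialSum (x ^_)
  ^>0 : ∀ k → x ^ k >0
  ^>0 zero    = 1>0
  ^>0 (suc k) = *->0 x>0 (^>0 k)
  term>0 : ∀ k → fromℚ (1/! k) * x ^ k >0
  term>0 k = *->0 (fromℚ>0 (ℚ.positive⁻¹ (1/! k) {{ℚ.normalize-pos 1 (k !) {{k ℕ.!≢0}}}})) (^>0 k)
  partialSum≥ : ∀ n → ¬ (1ℝ + x) - S (suc (suc n)) >0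
  partialSum≥ zero = ≋0⇒≯0 (solve 1 (λ x → (con 1ℚ :+ x) :-
    ((con 0ℚ :+ con 1ℚ :* con 1ℚ) :+ con 1ℚ :* (x :* con 1ℚ)) := con 0ℚ) ≋-refl x)
  partialSum≥ (suc n) p = partialSum≥ n (>0-cong
    (solve 3 (λ x s t → ((con 1ℚ :+ x) :- (s :+ t)) :+ t := (con 1ℚ :+ x) :- s) ≋-refl
      x (S (suc (suc n))) (fromℚ (1/! (suc (suc n))) * x ^ suc (suc n)))
    (+->0 p (term>0 (suc (suc n)))))

-- The positive x is (exp x - 1) + ((1 + x) - exp x), and the second summand is not positive.
exp-1>0 : ∀ {x} → x >0 → exp x - 1ℝ >0
exp-1>0 {x} x>0 = [ id , ⊥-elim ∘ exp≥1+ x>0 ]′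
  (>0-cotransitive (exp x - 1ℝ) ((1ℝ + x) - exp x)
    (>0-cong (solve 2 (λ x e → x := (e :- con 1ℚ) :+ ((con 1ℚ :+ x) :- e)) ≋-refl x (exp x)) x>0))

>0⇒exp>0 : ∀ {x} → x >0 → exp x >0
>0⇒exp>0 {x} x>0 = >0-cong (solve 1 (λ e → (e :- con 1ℚ) :+ con 1ℚ := e) ≋-refl (exp x))
  (+->0 (exp-1>0 x>0) 1>0)

-- Constructively, one of x and 1 − x is positive, and exp x * exp (1 − x) ≋ exp 1.
exp>0 : ∀ x → exp x >0
exp>0 x = [ >0⇒exp>0 , exp>0-from-1-x ]′
  (>0-cotransitive x (1ℝ - x) (>0-cong (solve 1 (λ x → con 1ℚ := x :+ (con 1ℚ :- x)) ≋-refl x) 1>0))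
  where
  exp*exp≋exp1 : exp x * exp (1ℝ - x) ≋ exp 1ℝ
  exp*exp≋exp1 = ≋-trans (exp-+ x (1ℝ - x))
    (exp-cong (solve 1 (λ x → x :+ (con 1ℚ :- x) := con 1ℚ) ≋-refl x))
  exp>0-from-1-x : 1ℝ - x >0 → exp x >0
  exp>0-from-1-x 1-x>0 = *-cancelʳ->0
    (>0-cong (≋-sym exp*exp≋exp1) (>0⇒exp>0 1>0)) (>0⇒exp>0 1-x>0)

exp-mono : ∀ {x y} → y - x >0 → exp y - exp x >0
exp-mono {x} {y} y-x>0 = >0-cong
  (≋-trans (solve 2 (λ e f → e :* (f :- con 1ℚ) := e :* f :- e) ≋-refl (exp x) (exp (y - x)))
    (+-congʳ (≋-trans (exp-+ x (y - x))
      (exp-cong (solve 2 (λ x y → x :+ (y :- x) := y) ≋-refl x y)))))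
  (*->0 (exp>0 x) (exp-1>0 y-x>0))

-- Monotonicity excludes y < x, so y - x has neither sign and vanishes; but then exp y - exp x
-- vanishes too.
exp-reflects : ∀ {x y} → ¬ y - x >0 → ¬ exp y - exp x >0
exp-reflects {x} {y} y-x≯0 expy-expx>0 =
  ≋0⇒≯0 (x≋y⇒x-y≋0 (exp-cong (x-y≋0⇒x≋y (≯0⇒≋0 (y - x) y-x≯0 y-x≮0)))) expy-expx>0
  where
  y-x≮0 : ¬ - (y - x) >0
  y-x≮0 x-y>0 = >0-asym
    (solve 2 (λ e f → (f :- e) :+ (e :- f) := con 0ℚ) ≋-refl (exp x) (exp y)) expy-expx>0
    (exp-mono (>0-cong (solve 2 (λ x y → :- (y :- x) := x :- y) ≋-refl x y) x-y>0))

-- The spectrum of the Hessian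

-- The definitions of Defs on syntactic polynomials, so that the ring solver
-- can evaluate a characteristic polynomial.
module Reified (m : ℕ) where
  open ℝSolver

  P = Polynomial m

  power : P → ℕ → P
  power p zero    = con 1ℚ
  power p (suc k) = p :* power p k

  sumP prodP : ∀ {n} → Vector P n → P
  sumP = foldr _:+_ (con 0ℚ)
  prodP = foldr _:*_ (con 1ℚ)

  detP : ∀ {n} → (Fin n → Fin n → P) → P
  detP {zero}  A = con 1ℚ
  detP {suc n} A = sumP λ j →
    (power (:- con 1ℚ) (toℕ j) :* A zero j) :* detP (λ r c → A (suc r) (punchIn j c))

  identityP : ∀ {n} → Fin n → Fin n → P
  identityP i j = con (if does (i Fin.≟ j) then 1ℚ else 0ℚ)

  _·P_ : ∀ {N} → Fin N → Fin N → Vec ℕ N → P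
  (i ·P j) γ = con (if does (Vec.≡-dec ℕ._≟_ (Vec.replicate _ 0 [ i ]%= suc [ j ]%= suc) γ) then 1ℚ else 0ℚ)

  ∂P : ∀ {N} → Fin N → (Vec ℕ N → P) → Vec ℕ N → P
  ∂P i f γ = con (fromℕ (suc (Vec.lookup γ i))) :* f (γ [ i ]%= suc)

  ΨP : P → P → Vec ℕ 4 → P
  ΨP α β γ = (uᵢ ·P uⱼ) γ :+ (zᵢ ·P zⱼ) γ
    :+ α :* ((zᵢ ·P uⱼ) γ :+ (zⱼ ·P uᵢ) γ)
    :+ β :* ((zᵢ ·P uᵢ) γ :+ (zⱼ ·P uⱼ) γ)

  hessianP : ∀ {N} → (Vec ℕ N → P) → Fin N → Fin N → P
  hessianP f i j = ∂P i (∂P j f) (Vec.replicate _ 0)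

-- Here a and b stand for α + β and α - β.
eigenvalues : ℝ → ℝ → Vector ℝ 4
eigenvalues a b 0F = 1ℝ + a
eigenvalues a b 1F = 1ℝ - a
eigenvalues a b 2F = - 1ℝ - b
eigenvalues a b 3F = b - 1ℝ

-- With `cosh` and `sinh` expanded this is a polynomial identity in exp (ϑ * s), exp s, exp (- s)
-- and x. The reified matrix evaluates to the real one by computation.
Ψ-charpoly : ∀ ϑ s x → det (λ i j → x * identity i j - hessian (Ψ ϑ s) i j) ≋
  ∏ (λ i → x - eigenvalues (exp (ϑ * s) * exp s) (exp (ϑ * s) * exp (- s)) i)
Ψ-charpoly ϑ s x = solve 4 (λ e p q x →
    detP (λ i j → x :* identityP i j :-
      hessianP (ΨP (e :* (con ½ :* (p :+ q))) (e :* (con ½ :* (p :- q)))) i j) :=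
    prodP (λ i → x :- eigenvaluesP (e :* p) (e :* q) i))
  ≋-refl (exp (ϑ * s)) (exp s) (exp (- s)) x
  where
  open Reified 4
  open ℝSolver
  eigenvaluesP : P → P → Fin 4 → P
  eigenvaluesP a b 0F = con 1ℚ :+ a
  eigenvaluesP a b 1F = con 1ℚ :- a
  eigenvaluesP a b 2F = :- con 1ℚ :- b
  eigenvaluesP a b 3F = b :- con 1ℚ

μ-eigenvalues : ∀ ϑ s → HasEigenvalues (hessian (Ψ ϑ s)) (μ ϑ s)
μ-eigenvalues ϑ s x = unwrap (≋-trans (Ψ-charpoly ϑ s x) (∏-cong λ i → +-congˡ {x} (-‿cong (eq i))))
  where
  a≋ : exp (ϑ * s) * exp s ≋ exp ((ϑ + 1ℝ) * s)
  a≋ = ≋-trans (exp-+ (ϑ * s) s)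
    (exp-cong (solve 2 (λ ϑ s → ϑ :* s :+ s := (ϑ :+ con 1ℚ) :* s) ≋-refl ϑ s))
  b≋ : exp (ϑ * s) * exp (- s) ≋ exp ((ϑ - 1ℝ) * s)
  b≋ = ≋-trans (exp-+ (ϑ * s) (- s))
    (exp-cong (solve 2 (λ ϑ s → ϑ :* s :+ :- s := (ϑ :- con 1ℚ) :* s) ≋-refl ϑ s))
  eq : ∀ i → eigenvalues (exp (ϑ * s) * exp s) (exp (ϑ * s) * exp (- s)) i ≋ μ ϑ s i
  eq 0F = +-congˡ a≋
  eq 1F = +-congˡ (-‿cong a≋)
  eq 2F = +-congˡ (-‿cong b≋)
  eq 3F = +-congʳ b≋

module _ (ϑ s : ℝ) where

  private
    a = exp ((ϑ + 1ℝ) * s)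
    b = exp ((ϑ - 1ℝ) * s)

  μ₁>0 : μ₁ ϑ s >0
  μ₁>0 = +->0 1>0 (exp>0 ((ϑ + 1ℝ) * s))

  μ₂≋0 : (ϑ + 1ℝ) * s ≋ 0ℝ → μ₂ ϑ s ≋ 0ℝ
  μ₂≋0 eq = x≋y⇒x-y≋0 (≋-sym (exp-0 eq))

  μ₄≋0 : (ϑ - 1ℝ) * s ≋ 0ℝ → μ₄ ϑ s ≋ 0ℝ
  μ₄≋0 eq = x≋y⇒x-y≋0 (exp-0 eq)

  module _ (s>0 : s >0) where

    μ₂>0 : - 1ℝ - ϑ >0 → μ₂ ϑ s >0
    -- 1 is read as exp 0, so that monotonicity applies.
    μ₂>0 -1-ϑ>0 = >0-cong (+-congʳ (exp-0 ≋-refl))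
      (exp-mono (>0-cong (solve 2 (λ ϑ s → (:- con 1ℚ :- ϑ) :* s := con 0ℚ :- (ϑ :+ con 1ℚ) :* s) ≋-refl ϑ s)
        (*->0 -1-ϑ>0 s>0)))

    μ₄>0 : ϑ - 1ℝ >0 → μ₄ ϑ s >0
    μ₄>0 ϑ-1>0 = exp-1>0 (*->0 ϑ-1>0 s>0)

    μ₂≯0 : ¬ - 1ℝ - ϑ >0 → ¬ μ₂ ϑ s >0
    μ₂≯0 h μ₂>0 = exp-reflects {(ϑ + 1ℝ) * s} {0ℝ}
      (λ p → h (*-cancelʳ->0 {y = s}
        (>0-cong (solve 2 (λ ϑ s → con 0ℚ :- (ϑ :+ con 1ℚ) :* s := (:- con 1ℚ :- ϑ) :* s) ≋-refl ϑ s) p) s>0))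
      (>0-cong (+-congʳ (≋-sym (exp-0 ≋-refl))) μ₂>0)

    μ₃≯0 : ¬ μ₃ ϑ s >0
    μ₃≯0 μ₃>0 = >0-asym
      (solve 1 (λ b → (:- con 1ℚ :- b) :+ (con 1ℚ :+ b) := con 0ℚ) ≋-refl b)
      μ₃>0 (+->0 1>0 (exp>0 ((ϑ - 1ℝ) * s)))

    μ₄≯0 : ¬ ϑ - 1ℝ >0 → ¬ μ₄ ϑ s >0
    μ₄≯0 h μ₄>0 = exp-reflects {0ℝ} {(ϑ - 1ℝ) * s}
      (λ p → h (*-cancelʳ->0 {y = s}
        (>0-cong (solve 1 (λ z → z :- con 0ℚ := z) ≋-refl ((ϑ - 1ℝ) * s)) p) s>0))
      (>0-cong (+-congˡ (-‿cong (≋-sym (exp-0 ≋-refl)))) μ₄>0)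

    at-most-one : ¬ - 1ℝ - ϑ >0 → ¬ ϑ - 1ℝ >0 → AtMostOnePositiveEigenvalue (hessian (Ψ ϑ s))
    at-most-one -1≤ϑ ϑ≤1 = μ ϑ s , μ-eigenvalues ϑ s ,
      λ i j 0<μi 0<μj → trans (first i (0<⇒>0 0<μi)) (sym (first j (0<⇒>0 0<μj)))
      where
      first : ∀ i → μ ϑ s i >0 → i ≡ 0F
      first 0F μ>0 = refl
      first 1F μ>0 = ⊥-elim (μ₂≯0 -1≤ϑ μ>0)
      first 2F μ>0 = ⊥-elim (μ₃≯0 μ>0)
      first 3F μ>0 = ⊥-elim (μ₄≯0 ϑ≤1 μ>0)

    -1≤ϑ : AtMostOnePositiveEigenvalue (hessian (Ψ ϑ s)) → - 1ℝ ≤ ϑ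
    -1≤ϑ atMostOne ϑ<-1 = distinct-positive-eigenvalues (hessian (Ψ ϑ s)) (μ ϑ s) (μ-eigenvalues ϑ s) 0F 1F
      μ₁>0 (μ₂>0 (<⇒>0 ϑ (- 1ℝ) ϑ<-1))
      -- The two eigenvalues differ by 2a > 0.
      (>0-cong (solve 1 (λ a → a :+ a := (con 1ℚ :+ a) :- (con 1ℚ :- a)) ≋-refl a)
        (+->0 (exp>0 ((ϑ + 1ℝ) * s)) (exp>0 ((ϑ + 1ℝ) * s))))
      atMostOne

    ϑ≤1 : AtMostOnePositiveEigenvalue (hessian (Ψ ϑ s)) → ϑ ≤ 1ℝ
    ϑ≤1 atMostOne 1<ϑ = distinct-positive-eigenvalues (hessian (Ψ ϑ s)) (μ ϑ s) (μ-eigenvalues ϑ s) 0F 3F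
      μ₁>0 (μ₄>0 (<⇒>0 1ℝ ϑ 1<ϑ))
      -- The difference is 2 + (a - b), and a > b because the exponents differ by 2s > 0.
      (>0-cong (solve 2 (λ a b → (con 1ℚ :+ con 1ℚ) :+ (a :- b) := (con 1ℚ :+ a) :- (b :- con 1ℚ)) ≋-refl a b)
        (+->0 (+->0 1>0 1>0) (exp-mono
          (>0-cong (solve 2 (λ ϑ s → s :+ s := (ϑ :+ con 1ℚ) :* s :- (ϑ :- con 1ℚ) :* s) ≋-refl ϑ s)
            (+->0 s>0 s>0)))))
      atMostOne

    atMostOne⇔ : AtMostOnePositiveEigenvalue (hessian (Ψ ϑ s)) ⇔ (- 1ℝ ≤ ϑ × ϑ ≤ 1ℝ)
    atMostOne⇔ = mk⇔ {A = AtMostOnePositiveEigenvalue (hessian (Ψ ϑ s))} {B = - 1ℝ ≤ ϑ × ϑ ≤ 1ℝ}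
      (λ h → -1≤ϑ h , ϑ≤1 h)
      (λ h → at-most-one (λ p → proj₁ h (>0⇒< {ϑ} { - 1ℝ} p)) (λ p → proj₂ h (>0⇒< {1ℝ} {ϑ} p)))

-- Boundary values of ϑ, the case s = 0, and the theorem

μ₂-boundary : ∀ ϑ s → ϑ ≋ - 1ℝ → μ₂ ϑ s ≋ 0ℝ
μ₂-boundary ϑ s ϑ≋-1 = μ₂≋0 ϑ s (≋-trans (*-congʳ (+-congʳ ϑ≋-1))
  (solve 1 (λ s → (:- con 1ℚ :+ con 1ℚ) :* s := con 0ℚ) ≋-refl s))

μ₄-boundary : ∀ ϑ s → ϑ ≋ 1ℝ → μ₄ ϑ s ≋ 0ℝ
μ₄-boundary ϑ s ϑ≋1 = μ₄≋0 ϑ s (≋-trans (*-congʳ (+-congʳ ϑ≋1))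
  (solve 1 (λ s → (con 1ℚ :- con 1ℚ) :* s := con 0ℚ) ≋-refl s))

zero-spectrum : ∀ ϑ s → s ≋ 0ℝ →
  μ₁ ϑ s ≋ 2ℝ × μ₂ ϑ s ≋ 0ℝ × μ₃ ϑ s ≋ - 2ℝ × μ₄ ϑ s ≋ 0ℝ
zero-spectrum ϑ s s≋0 =
    +-congˡ (exp-0 (exponent≋0 (ϑ + 1ℝ)))
  , μ₂≋0 ϑ s (exponent≋0 (ϑ + 1ℝ))
  , ≋-trans (+-congˡ (-‿cong (exp-0 (exponent≋0 (ϑ - 1ℝ)))))
      (solve 0 (:- con 1ℚ :- con 1ℚ := :- (con 1ℚ :+ con 1ℚ)) ≋-refl)
  , μ₄≋0 ϑ s (exponent≋0 (ϑ - 1ℝ))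
  where
  exponent≋0 : ∀ x → x * s ≋ 0ℝ
  exponent≋0 x = ≋-trans (*-congˡ s≋0) (solve 1 (λ x → x :* con 0ℚ := con 0ℚ) ≋-refl x)

apply-T≋id : ∀ ϑ s → s ≋ 0ℝ → ∀ p k → apply (T ϑ s) p k ≋ p k
apply-T≋id ϑ s s≋0 p k = ≋-trans
  (∑-cong {f = λ j → T ϑ s k j * p j} λ j → *-congʳ (T≋identity k j)) (∑-identity k p)
  where
  T≋identity : ∀ i j → T ϑ s i j ≋ identity i j
  T≋identity = expᴹ≋identity (scale s (L ϑ)) λ i j → ≋-trans (*-congʳ s≋0)
    (solve 1 (λ x → con 0ℚ :* x := con 0ℚ) ≋-refl (L ϑ i j))

mainTheorem5 : (ϑ s : ℝ) → 0ℝ ≤ s →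
    HasEigenvalues (hessian (Ψ ϑ s)) (μ ϑ s)
    × (s ≈ 0ℝ →
    (μ₁ ϑ s ≈ 2ℝ × μ₂ ϑ s ≈ 0ℝ × μ₃ ϑ s ≈ - 2ℝ × μ₄ ϑ s ≈ 0ℝ)
    × (∀ p k → apply (T ϑ s) p k ≈ p k))
    × (0ℝ < s →
    (AtMostOnePositiveEigenvalue (hessian (Ψ ϑ s)) ⇔ (- 1ℝ ≤ ϑ × ϑ ≤ 1ℝ))
    × (ϑ ≈ - 1ℝ → μ₂ ϑ s ≈ 0ℝ)
    × (ϑ ≈ 1ℝ → μ₄ ϑ s ≈ 0ℝ)
    × (ϑ < - 1ℝ → 0ℝ < μ₁ ϑ s × 0ℝ < μ₂ ϑ s)
    × (1ℝ < ϑ → 0ℝ < μ₁ ϑ s × 0ℝ < μ₄ ϑ s)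
    × (¬ (- 1ℝ ≤ ϑ × ϑ ≤ 1ℝ) → ¬ IsLorentzian 2 (Ψ ϑ s)))
mainTheorem5 ϑ s _ = μ-eigenvalues ϑ s
  , (λ s≈0 → let μ₁≋2 , μ₂≋0 , μ₃≋-2 , μ₄≋0 = zero-spectrum ϑ s (wrap s≈0) in
        (unwrap μ₁≋2 , unwrap μ₂≋0 , unwrap μ₃≋-2 , unwrap μ₄≋0)
      , λ p k → unwrap (apply-T≋id ϑ s (wrap s≈0) p k))
  , λ 0<s → let s>0 = 0<⇒>0 {s} 0<s in
        atMostOne⇔ ϑ s s>0
      , (λ ϑ≈-1 → unwrap (μ₂-boundary ϑ s (wrap ϑ≈-1)))
      , (λ ϑ≈1 → unwrap (μ₄-boundary ϑ s (wrap ϑ≈1)))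
      , (λ ϑ<-1 → >0⇒0< (μ₁>0 ϑ s) , >0⇒0< (μ₂>0 ϑ s s>0 (<⇒>0 ϑ (- 1ℝ) ϑ<-1)))
      , (λ 1<ϑ → >0⇒0< (μ₁>0 ϑ s) , >0⇒0< (μ₄>0 ϑ s s>0 (<⇒>0 1ℝ ϑ 1<ϑ)))
      -- In degree 2 the sequence of derivatives is empty, so the Lorentzian condition speaks of the
      -- Hessian of Ψ itself.
      , λ outside lorentzian → outside (Equivalence.to (atMostOne⇔ ϑ s s>0)
          (IsLorentzian.hessians lorentzian (s≤s (s≤s z≤n)) []))
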